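{- Generalized Cops and Robber, on finite, simple, connected graphs $G$, parameterized by the vertex cover number $\mathsf{vcn}$ of $G$, admits a kernel with at most $\mathsf{vcn}+\mathsf{vcn}\cdot 2^{\mathsf{vcn}}$ vertices.
   Context: Generalized Cops and Robber. The input is $(G,\mathcal{C}_1,\ldots,\mathcal{C}_k,\mathcal{R})$: a graph $G$, cops $\mathcal{C}_1,\dots,\mathcal{C}_k$ and a single robber $\mathcal{R}$, with the following attributes. Each cop $\mathcal{C}_i$ has a speed $s_i\in\mathbb{N}$ and a reach $\lambda_i\ge 0$ (possibly different for each cop), and is designated active, lazy or flexible; the robber has speed $s_R\in\mathbb{N}$ and is designated active or flexible. The question is whether the cops have a winning strategy in the following perfect-information game. The cop player places each cop on a vertex (several cops may share a vertex), then the robber player places the robber on a vertex; then they alternate moves, cops first. In a cop move, a cop $\mathcal{C}_i$ that moves does so along at most $s_i$ edges; every active cop must move, at most one lazy cop moves, and a flexible cop may move or stay. In a robber move, the robber moves along a path with at most $s_R$ edges containing no vertex at distance at most $\lambda_i$ from the vertex of $\mathcal{C}_i$, for any $i$; an active robber must move, a flexible robber may stay. The robber cannot access (enter) a vertex at distance at most $\lambda_i$ from the vertex occupied by $\mathcal{C}_i$, and the cops win if at the end of a cop move some cop $\mathcal{C}_i$ is at distance at most $\lambda_i$ from the robber's vertex (with $\lambda_i=0$ this is the usual capture). The designation "active" is used only for agents of speed $1$ (the agent must move to an adjacent vertex in each of its turns). The vertex cover number of $G$ is the minimum size of a set $U\subseteq V(G)$ such that $V(G)\setminus U$ is independent. A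 kernel for a parameterized problem is (the output of) a polynomial-time algorithm that maps each instance $I$ with parameter value $p$ to an equivalent instance $I'$ of the same problem (i.e. $I$ is a Yes-instance iff $I'$ is) whose size is bounded by a computable function of $p$. "A kernel with at most $f(p)$ vertices" means that the graph of $I'$ has at most $f(p)$ vertices, where $p$ is the parameter of the input instance. -}

module Defs where

open import Data.Bool using (Bool; true; false; T)
open import Data.Fin using (Fin)
open import Data.Fin.Subset using (Subset; _∉_; ∣_∣)
open import Data.List using (List; []; _∷_; map)
open import Data.List.Relation.Unary.All using (All)
open import Data.List.Relation.Unary.Unique.Propositional using (Unique)
open import Data.Nat using (ℕ; zero; suc; _+_; _*_; _^_; _≤_; _<_)
open import Data.Nat.Binary using (ℕᵇ; 2[1+_]; 1+[2_]; fromℕ)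
open import Data.Product using (∃; ∃-syntax; Σ-syntax; _×_; _,_)
open import Data.Vec.Functional using (Vector; toList)
open import Function using (_⇔_)
open import Relation.Binary.PropositionalEquality using (_≡_; _≢_)
open import Relation.Nullary using (¬_)

record Graph (n : ℕ) : Set where
  field
    adj    : Fin n → Fin n → Bool
    symm   : ∀ u v → adj u v ≡ adj v u
    irrefl : ∀ v → adj v v ≡ false

  Adj : Fin n → Fin n → Set
  Adj u v = T (adj u v)

  data Walk : Fin n → Fin n → ℕ → Set where
    []  : ∀ {u} → Walk u u 0
    _∷_ : ∀ {u v w ℓ} → Adj u v → Walk v w ℓ → Walk u w (suc ℓ)

  vertices : ∀ {u v ℓ} → Walk u v ℓ → List (Fin n)
  vertices {u} []      = u ∷ []
  vertices {u} (_ ∷ w) = u ∷ vertices w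

  IsPath : ∀ {u v ℓ} → Walk u v ℓ → Set
  IsPath w = Unique (vertices w)

  -- The distance of u and v is at most d.
  Within : ℕ → Fin n → Fin n → Set
  Within d u v = ∃[ ℓ ] ℓ ≤ d × Walk u v ℓ

  Connected : Set
  Connected = ∀ u v → ∃[ ℓ ] Walk u v ℓ

  Independent : (Fin n → Set) → Set
  Independent S = ∀ u v → S u → S v → ¬ Adj u v

  VertexCover : Subset n → Set
  VertexCover U = Independent (_∉ U)

  VertexCoverNumber : ℕ → Set
  VertexCoverNumber p =
    (∃[ U ] VertexCover U × ∣ U ∣ ≡ p) × (∀ U → VertexCover U → p ≤ ∣ U ∣)

data CopMode : Set where
  active lazy flexible : CopMode

data RobberMode : Set where
  active flexible : RobberMode

record Cop : Set where
  field
    mode        : CopMode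
    speed       : ℕ
    reach       : ℕ
    speed>0     : 0 < speed
    active⇒unit : mode ≡ active → speed ≡ 1

record Robber : Set where
  field
    mode        : RobberMode
    speed       : ℕ
    speed>0     : 0 < speed
    active⇒unit : mode ≡ active → speed ≡ 1

-- The graph without vertices and the empty team of cops are allowed.  With
-- parameter 0 a kernel of at most p + p * 2 ^ p vertices has no vertices at
-- all; the cops then win exactly when there is no cop to be placed.
record Instance : Set where
  field
    order     : ℕ
    graph     : Graph order
    connected : Graph.Connected graph
    #cops     : ℕ
    cops      : Vector Cop #cops
    robber    : Robber

module Game (I : Instance) where
  open Instance I
  open Graph graph
  private
    module C (i : Fin #cops) = Cop (cops i)
    module R = Robber robber

  Vertex : Set
  Vertex = Fin order

  Positions : Set
  Positions = Fin #cops → Vertex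

  Guarded : Positions → Vertex → Set
  Guarded c v = ∃[ i ] Within (C.reach i) (c i) v

  record CopMove (c c′ : Positions) : Set where
    field
      withinSpeed : ∀ i → Within (C.speed i) (c i) (c′ i)
      activeMove  : ∀ i → C.mode i ≡ active → Adj (c i) (c′ i)
      oneLazy     : ∀ i j → C.mode i ≡ lazy → C.mode j ≡ lazy →
                    c i ≢ c′ i → c j ≢ c′ j → i ≡ j

  record RobberMove (c : Positions) (r r′ : Vertex) : Set where
    field
      {length}   : ℕ
      walk       : Walk r r′ length
      isPath     : IsPath walk
      length≤    : length ≤ R.speed
      unguarded  : All (λ v → ¬ Guarded c v) (vertices walk)
      activeMove : R.mode ≡ active → Adj r r′

  -- Strategies of the cops, to move, that force a win in finitely many moves.
  -- An active robber who is left without a legal move has lost; active cops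
  -- who cannot move have not won.
  data WinningStrategy (c : Positions) (r : Vertex) : Set where
    capture  : ∀ c′ → CopMove c c′ → Guarded c′ r → WinningStrategy c r
    continue : ∀ c′ → CopMove c c′ →
               (∀ r′ → RobberMove c′ r r′ → WinningStrategy c′ r′) →
               WinningStrategy c r

  -- Vertices within the reach of a cop are inaccessible to the robber
  -- already when he is placed.
  CopsWin : Set
  CopsWin = Σ[ c ∈ Positions ] (∀ r → ¬ Guarded c r → WinningStrategy c r)

-- A pointfree form of Jones's language WHILE on binary trees (N. D. Jones,
-- Computability and Complexity from a Programming Perspective), where every
-- operation takes one unit of time.  Trees being shared, it simulates and is
-- simulated by Turing machines with polynomial overhead, apart from writing
-- out the result, for which PolynomialTime charges separately.

data Tree : Set where
  nil : Tree
  _∙_ : Tree → Tree → Tree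

infixr 5 _∙_

size : Tree → ℕ
size nil     = 1
size (a ∙ b) = suc (size a + size b)

head tail : Tree → Tree
head nil     = nil
head (a ∙ b) = a
tail nil     = nil
tail (a ∙ b) = b

infixr 6 _⨾_

data Program : Set where
  id nil hd tl       : Program
  cons               : Program → Program → Program
  _⨾_                : Program → Program → Program
  if_then_else_      : Program → Program → Program → Program
  while_loop_        : Program → Program → Program

infix 4 _⊢_⇓_cost_

-- nil counts as false, every other tree as true.
data _⊢_⇓_cost_ : Program → Tree → Tree → ℕ → Set where
  id    : ∀ {x} → id ⊢ x ⇓ x cost 1
  nil   : ∀ {x} → nil ⊢ x ⇓ nil cost 1
  hd    : ∀ {x} → hd ⊢ x ⇓ head x cost 1
  tl    : ∀ {x} → tl ⊢ x ⇓ tail x cost 1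
  cons  : ∀ {p q x y z s t} →
          p ⊢ x ⇓ y cost s → q ⊢ x ⇓ z cost t →
          cons p q ⊢ x ⇓ y ∙ z cost suc (s + t)
  _⨾_   : ∀ {p q x y z s t} →
          p ⊢ x ⇓ y cost s → q ⊢ y ⇓ z cost t →
          p ⨾ q ⊢ x ⇓ z cost suc (s + t)
  if-true  : ∀ {b p q x a a′ y s t} →
          b ⊢ x ⇓ a ∙ a′ cost s → p ⊢ x ⇓ y cost t →
          if b then p else q ⊢ x ⇓ y cost suc (s + t)
  if-false : ∀ {b p q x y s t} →
          b ⊢ x ⇓ nil cost s → q ⊢ x ⇓ y cost t →
          if b then p else q ⊢ x ⇓ y cost suc (s + t)
  stop  : ∀ {b p x s} →
          b ⊢ x ⇓ nil cost s →
          while b loop p ⊢ x ⇓ x cost suc s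
  again : ∀ {b p x a a′ y z s t u} →
          b ⊢ x ⇓ a ∙ a′ cost s → p ⊢ x ⇓ y cost t →
          while b loop p ⊢ y ⇓ z cost u →
          while b loop p ⊢ x ⇓ z cost suc (s + t + u)

numeral : ℕ → Tree
numeral zero    = nil
numeral (suc n) = nil ∙ numeral n

Computable : (ℕ → ℕ) → Set
Computable g = ∃[ P ] ∀ n → ∃[ t ] P ⊢ numeral n ⇓ numeral (g n) cost t

PolynomialTime : {A : Set} → (A → Tree) → (A → A) → Set
PolynomialTime encode f =
  ∃[ P ] ∃[ a ] ∃[ e ] ∀ x → ∃[ t ]
    P ⊢ encode x ⇓ encode (f x) cost t ×
    t + size (encode (f x)) ≤ a * size (encode x) ^ e

record ParameterizedProblem : Set₁ where
  field
    Input     : Set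
    encode    : Input → Tree
    Yes       : Input → Set
    Parameter : Input → ℕ → Set

record Kernel (Π : ParameterizedProblem) : Set where
  open ParameterizedProblem Π
  field
    reduce     : Input → Input
    polynomial : PolynomialTime encode reduce
    equivalent : ∀ I → Yes I ⇔ Yes (reduce I)
    bound      : ℕ → ℕ
    computable : Computable bound
    bounded    : ∀ I p → Parameter I p → size (encode (reduce I)) ≤ bound p

-- Speeds and reaches are written in binary.

encodeList : List Tree → Tree
encodeList []       = nil
encodeList (x ∷ xs) = x ∙ encodeList xs

encodeBool : Bool → Tree
encodeBool false = nil
encodeBool true  = nil ∙ nil

encodeℕᵇ : ℕᵇ → Tree
encodeℕᵇ ℕᵇ.zero  = nil
encodeℕᵇ 2[1+ b ] = encodeBool false ∙ encodeℕᵇ b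
encodeℕᵇ 1+[2 b ] = encodeBool true ∙ encodeℕᵇ b

encodeℕ : ℕ → Tree
encodeℕ n = encodeℕᵇ (fromℕ n)

encodeGraph : ∀ {n} → Graph n → Tree
encodeGraph G =
  encodeList (toList λ u → encodeList (toList λ v → encodeBool (Graph.adj G u v)))

encodeCopMode : CopMode → Tree
encodeCopMode active   = nil
encodeCopMode lazy     = nil ∙ nil
encodeCopMode flexible = nil ∙ nil ∙ nil

encodeRobberMode : RobberMode → Tree
encodeRobberMode active   = nil
encodeRobberMode flexible = nil ∙ nil

encodeCop : Cop → Tree
encodeCop C = encodeCopMode mode ∙ encodeℕ speed ∙ encodeℕ reach
  where open Cop C

encodeRobber : Robber → Tree
encodeRobber R = encodeRobberMode mode ∙ encodeℕ speed
  where open Robber R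

encodeInstance : Instance → Tree
encodeInstance I =
  encodeGraph graph ∙ encodeList (map encodeCop (toList cops)) ∙ encodeRobber robber
  where open Instance I

GeneralizedCopsAndRobber/vcn : ParameterizedProblem
GeneralizedCopsAndRobber/vcn = record
  { Input     = Instance
  ; encode    = encodeInstance
  ; Yes       = Game.CopsWin
  ; Parameter = λ I → Graph.VertexCoverNumber (Instance.graph I)
  }

{-# OPTIONS --safe #-}
module Submission where

-- Let k be the number of cops.  If k + 1 vertices of every class of false twins
-- are kept, some vertex of the class of the robber is free of cops, so he can be
-- shadowed by a twin in the smaller graph; a cop who would land on the shadow
-- captures the robber instead.  To have k + 1 ≤ vcn, cover the vertices greedily
-- by d disjoint stars.  The centres of the stars dominate the graph, so that
-- k ≥ d cops win with their first move; and one edge of each star gives a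
-- matching, so that k < d implies k < vcn.  In the reduced graph, speeds and
-- reaches beyond its order can be shortened.

-- There, a kept vertex outside a cover `U` has one of `2 ^ ∣ U ∣` neighbourhoods in `U`, and each
-- class keeps at most `k + 1 ≤ ∣ U ∣` vertices; this is the product in the bound, and the reason
-- why `k + 1` has to be compared with the cover at all. A shadow must avoid the cops because twins
-- are ends of the same walks from a given vertex except for the empty walk: only at distance 0 can
-- a cop tell them apart. Bounding the order does not yet bound the instance, since speeds and
-- reaches may have arbitrarily many digits; hence their truncation. `PolynomialTime` asks for an
-- actual program. Therefore every choice of the reduction is made by a filter or by `greedy` along
-- one fixed list of vertices, and program and reduction have the same shape.

open import Defs
open import Data.Bool using (Bool; true; false; not; _∧_; _∨_; T; T?)
import Data.Bool as Bool
open import Data.Empty using (⊥-elim)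
open import Data.Fin using (Fin; zero; suc; toℕ; fromℕ; fromℕ<; inject₁; inject≤; lower₁; join; combine; funToFin; finToFun; splitAt)
import Data.Fin.Properties as Fin
open import Data.Fin.Subset as Subset using (Subset; ∣_∣)
import Data.Fin.Subset.Properties as Subset
open import Data.List using (List; []; _∷_; map; filter; length; lookup; tabulate; downFrom)
open import Data.List.Properties using (filter-accept; filter-reject; length-downFrom; length-map; length-tabulate; map-cong; map-tabulate; map-∘; tabulate-cong; tabulate-lookup)
open import Data.List.Membership.DecPropositional using (_∈?_)
open import Data.List.Membership.Propositional using (_∈_; _∉_; find)
open import Data.List.Membership.Propositional.Properties using (∈-filter⁺; ∈-filter⁻; ∈-lookup; ∈-map⁺)
open import Data.List.Relation.Binary.Subset.Propositional using (_⊆_)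
open import Data.List.Relation.Unary.All as All using (All; []; _∷_)
import Data.List.Relation.Unary.All.Properties as All
import Data.List.Relation.Unary.Any.Properties as Any
open import Data.List.Relation.Unary.AllPairs using ([]; _∷_)
open import Data.List.Relation.Unary.Any as Any using (Any; here; there)
open import Data.List.Relation.Unary.Unique.Propositional using (Unique)
import Data.List.Relation.Unary.Unique.Propositional.Properties as Unique
open import Data.Nat using (ℕ; zero; suc; _+_; _*_; _^_; _∸_; _≤_; _<_; z≤n; s≤s; _≤?_; _<?_)
open import Data.Nat.Binary using (ℕᵇ; 2[1+_]; 1+[2_]) renaming (fromℕ to toBinary; toℕ to fromBinary)
open import Data.Nat.Binary.Properties using () renaming (toℕ-fromℕ to fromBinary-toBinary; fromℕ-toℕ to toBinary-fromBinary)
open import Data.Nat.Properties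
open import Data.Product using (∃-syntax; Σ-syntax; _×_; _,_; proj₁; proj₂)
open import Data.Sum using (_⊎_; inj₁; inj₂)
open import Data.Sum.Properties using (inj₁-injective; inj₂-injective)
open import Data.Vec using ([]; _∷_; here; there)
open import Data.Vec.Functional using (Vector; toList)
open import Function using (_∘_; const; mk⇔; _⇔_)
open import Function.Construct.Composition using (_⇔-∘_)
open import Level using (0ℓ)
open import Relation.Binary.PropositionalEquality
open import Relation.Nullary using (Dec; does; yes; no; ¬_; ¬?; contradiction; _×-dec_; _⊎-dec_)
open import Relation.Nullary.Decidable using (does-⇔; map′)
open import Relation.Unary using (Pred; Decidable)

-- Programs and their running time

-- Every tree is read as a list whose elements hang off its right spine; unary numbers are lists of
-- `nil`.
foldTree : (Tree → Tree → Tree) → Tree → Tree → Tree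
foldTree f z nil     = z
foldTree f z (e ∙ t) = f e (foldTree f z t)

reverseOnto : Tree → Tree → Tree
reverseOnto nil     o = o
reverseOnto (e ∙ t) o = reverseOnto t (e ∙ o)

branch : Tree → Tree → Tree → Tree
branch nil     y z = z
branch (_ ∙ _) y z = y

-- Value and exact running time are total functions. Loops enter only as list reversal and as folds,
-- so every program built from these pieces terminates by construction.
record Computation : Set where
  field
    fun  : Tree → Tree
    prog : Program
    time : Tree → ℕ
    runs : ∀ x → prog ⊢ x ⇓ fun x cost time x

module Computations where
  open Computation

  idᶜ nilᶜ hdᶜ tlᶜ : Computation
  idᶜ  = record { fun = λ x → x ; prog = id ; time = λ _ → 1 ; runs = λ _ → id }
  nilᶜ = record { fun = λ _ → nil ; prog = nil ; time = λ _ → 1 ; runs = λ _ → nil }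
  hdᶜ  = record { fun = head ; prog = hd ; time = λ _ → 1 ; runs = λ _ → hd }
  tlᶜ  = record { fun = tail ; prog = tl ; time = λ _ → 1 ; runs = λ _ → tl }

  consᶜ seqᶜ : Computation → Computation → Computation
  consᶜ p q = record
    { fun  = λ x → fun p x ∙ fun q x
    ; prog = cons (prog p) (prog q)
    ; time = λ x → suc (time p x + time q x)
    ; runs = λ x → cons (runs p x) (runs q x)
    }
  seqᶜ p q = record
    { fun  = λ x → fun q (fun p x)
    ; prog = prog p ⨾ prog q
    ; time = λ x → suc (time p x + time q (fun p x))
    ; runs = λ x → runs p x ⨾ runs q (fun p x)
    }

  ifᶜ : Computation → Computation → Computation → Computation
  ifᶜ b p q = record
    { fun  = λ x → branch (fun b x) (fun p x) (fun q x)
    ; prog = if prog b then prog p else prog q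
    ; time = time′
    ; runs = runs′
    }
    where
    branchTime : Tree → ℕ → ℕ → ℕ
    branchTime nil     s t = t
    branchTime (_ ∙ _) s t = s
    time′ : Tree → ℕ
    time′ x = suc (time b x + branchTime (fun b x) (time p x) (time q x))
    runs′ : ∀ x → if prog b then prog p else prog q
                  ⊢ x ⇓ branch (fun b x) (fun p x) (fun q x) cost time′ x
    runs′ x with fun b x | runs b x
    ... | nil   | r = if-false r (runs q x)
    ... | _ ∙ _ | r = if-true r (runs p x)

  branchTime≤ : ∀ b p q x → time (ifᶜ b p q) x ≤ suc (time b x + (time p x + time q x))
  branchTime≤ b p q x with fun b x
  ... | nil   = s≤s (+-monoʳ-≤ (time b x) (m≤n+m _ _))
  ... | _ ∙ _ = s≤s (+-monoʳ-≤ (time b x) (m≤m+n _ _))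

  reverseLoop : Program
  reverseLoop = while hd loop cons (hd ⨾ tl) (cons (hd ⨾ hd) tl)

  reverseTime : Tree → ℕ
  reverseTime nil     = 2
  reverseTime (_ ∙ t) = 11 + reverseTime t

  reverseLoop-runs : ∀ t o →
    reverseLoop ⊢ t ∙ o ⇓ nil ∙ reverseOnto t o cost reverseTime t
  reverseLoop-runs nil     o = stop hd
  reverseLoop-runs (e ∙ t) o =
    again hd (cons (hd ⨾ tl) (cons (hd ⨾ hd) tl)) (reverseLoop-runs t (e ∙ o))

  -- The state of the loop consists of the remaining list, reversed, the value
  -- of the fold so far, and the input.
  module Fold (l z s : Computation) where
    body loop : Program
    body = cons (hd ⨾ tl) (cons (cons (hd ⨾ hd) tl ⨾ prog s) (tl ⨾ tl))
    loop = while hd loop body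

    value : Tree → Tree → Tree
    value x = foldTree (λ e a → fun s (e ∙ a ∙ x)) (fun z x)

    bodyTime : ℕ → ℕ
    bodyTime c = suc (3 + suc (suc (5 + c) + 3))

    loopTime : Tree → Tree → ℕ → ℕ
    loopTime x nil     u = u
    loopTime x (e ∙ t) u =
      loopTime x t (suc (1 + bodyTime (time s (e ∙ value x t ∙ x)) + u))

    -- A loop run is built from its end, so the run that follows the elements of `t` is assumed and
    -- iterations are put in front of it. As the list has been reversed, the loop meets its last
    -- element first and computes a right fold.
    loop-runs : ∀ {x y u} t {o} →
      loop ⊢ o ∙ value x t ∙ x ⇓ y cost u →
      loop ⊢ reverseOnto t o ∙ fun z x ∙ x ⇓ y cost loopTime x t u
    loop-runs nil     r = r
    loop-runs {x} (e ∙ t) r =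
      loop-runs t
        (again hd (cons (hd ⨾ tl) (cons (cons (hd ⨾ hd) tl ⨾ runs s (e ∙ value x t ∙ x)) (tl ⨾ tl))) r)

    foldᶜ : Computation
    foldᶜ = record
      { fun  = λ x → value x (fun l x)
      ; prog = cons (prog l ⨾ cons id nil ⨾ reverseLoop ⨾ tl) (cons (prog z) id)
               ⨾ loop ⨾ tl ⨾ hd
      ; time = λ x →
          suc (suc (suc (time l x + suc (3 + suc (reverseTime (fun l x) + 1))) + suc (time z x + 1))
               + suc (loopTime x (fun l x) 2 + 3))
      ; runs = λ x →
          cons (runs l x ⨾ cons id nil ⨾ reverseLoop-runs (fun l x) nil ⨾ tl) (cons (runs z x) id)
          ⨾ loop-runs (fun l x) (stop hd) ⨾ tl ⨾ hd
      }

  open Fold public using (foldᶜ)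

  literalᶜ : Tree → Computation
  literalᶜ nil     = nilᶜ
  literalᶜ (a ∙ b) = consᶜ (literalᶜ a) (literalᶜ b)

-- Polynomial bounds

infixl 6 _⊕_
infixl 7 _⊗_
infixl 8 _⊚_

-- Composition is a constructor because running one program on the output of another composes their
-- bounds. The form `a * n ^ e` is reached only at the very end.
data Polynomial : Set where
  X           : Polynomial
  con         : ℕ → Polynomial
  _⊕_ _⊗_ _⊚_ : Polynomial → Polynomial → Polynomial

eval : Polynomial → ℕ → ℕ
eval X       n = n
eval (con c) n = c
eval (p ⊕ q) n = eval p n + eval q n
eval (p ⊗ q) n = eval p n * eval q n
eval (p ⊚ q) n = eval p (eval q n)

eval-mono : ∀ p {m n} → m ≤ n → eval p m ≤ eval p n
eval-mono X       m≤n = m≤n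
eval-mono (con c) m≤n = ≤-refl
eval-mono (p ⊕ q) m≤n = +-mono-≤ (eval-mono p m≤n) (eval-mono q m≤n)
eval-mono (p ⊗ q) m≤n = *-mono-≤ (eval-mono p m≤n) (eval-mono q m≤n)
eval-mono (p ⊚ q) m≤n = eval-mono p (eval-mono q m≤n)

-- Crude upper bounds: the degree of a sum is the sum of the degrees instead of their maximum. In a
-- composition, `suc (coefficient q)` keeps the inner bound positive even for a zero coefficient, so
-- that the monomial bound for `p` applies to it.
coefficient degree : Polynomial → ℕ
coefficient X       = 1
coefficient (con c) = c
coefficient (p ⊕ q) = coefficient p + coefficient q
coefficient (p ⊗ q) = coefficient p * coefficient q
coefficient (p ⊚ q) = coefficient p * suc (coefficient q) ^ degree p
degree X       = 1
degree (con c) = 0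
degree (p ⊕ q) = degree p + degree q
degree (p ⊗ q) = degree p + degree q
degree (p ⊚ q) = degree q * degree p

^-distribʳ-* : ∀ m n k → (m * n) ^ k ≡ m ^ k * n ^ k
^-distribʳ-* m n zero    = refl
^-distribʳ-* m n (suc k) = begin
  m * n * (m * n) ^ k       ≡⟨ cong (m * n *_) (^-distribʳ-* m n k) ⟩
  m * n * (m ^ k * n ^ k)   ≡⟨ [m*n]*[o*p]≡[m*o]*[n*p] m n (m ^ k) (n ^ k) ⟩
  m * m ^ k * (n * n ^ k)   ∎
  where open ≡-Reasoning

-- Restricted to positive arguments, since at 0 the monomial of `con 1 ⊕ X` vanishes. Sizes of trees
-- are positive.
eval≤monomial : ∀ p n → eval p (suc n) ≤ coefficient p * suc n ^ degree p
eval≤monomial X       n = ≤-reflexive (sym (trans (*-identityˡ _) (*-identityʳ _)))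
eval≤monomial (con c) n = ≤-reflexive (sym (*-identityʳ c))
eval≤monomial (p ⊕ q) n = begin
  eval p N + eval q N                      ≤⟨ +-mono-≤ (eval≤monomial p n) (eval≤monomial q n) ⟩
  a * N ^ d + b * N ^ e                    ≤⟨ +-mono-≤ (*-monoʳ-≤ a (^-monoʳ-≤ N (m≤m+n d e)))
                                                       (*-monoʳ-≤ b (^-monoʳ-≤ N (m≤n+m e d))) ⟩
  a * N ^ (d + e) + b * N ^ (d + e)        ≡⟨ *-distribʳ-+ (N ^ (d + e)) a b ⟨
  (a + b) * N ^ (d + e)                    ∎
  where
  open ≤-Reasoning
  N = suc n ; a = coefficient p ; b = coefficient q ; d = degree p ; e = degree q
eval≤monomial (p ⊗ q) n = begin
  eval p N * eval q N           ≤⟨ *-mono-≤ (eval≤monomial p n) (eval≤monomial q n) ⟩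
  a * N ^ d * (b * N ^ e)       ≡⟨ [m*n]*[o*p]≡[m*o]*[n*p] a (N ^ d) b (N ^ e) ⟩
  a * b * (N ^ d * N ^ e)       ≡⟨ cong (a * b *_) (^-distribˡ-+-* N d e) ⟨
  a * b * N ^ (d + e)           ∎
  where
  open ≤-Reasoning
  N = suc n ; a = coefficient p ; b = coefficient q ; d = degree p ; e = degree q
eval≤monomial (p ⊚ q) n = begin
  eval p (eval q N)               ≤⟨ eval-mono p (≤-trans (eval≤monomial q n) (*-monoˡ-≤ (N ^ e) (n≤1+n b))) ⟩
  eval p M                        ≤⟨ monomial-p (m^n>0 N e) ⟩
  a * M ^ d                       ≡⟨ cong (a *_) (^-distribʳ-* (suc b) (N ^ e) d) ⟩
  a * (suc b ^ d * (N ^ e) ^ d)   ≡⟨ *-assoc a (suc b ^ d) ((N ^ e) ^ d) ⟨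
  a * suc b ^ d * (N ^ e) ^ d     ≡⟨ cong (a * suc b ^ d *_) (^-*-assoc N e d) ⟩
  a * suc b ^ d * N ^ (e * d)     ∎
  where
  open ≤-Reasoning
  N = suc n ; a = coefficient p ; b = coefficient q ; d = degree p ; e = degree q
  M = suc b * N ^ e
  monomial-p : 1 ≤ N ^ e → eval p M ≤ a * M ^ d
  monomial-p pos with N ^ e
  ... | suc k = eval≤monomial p (k + b * suc k)

-- Trees are shared, so `cons id id` more than doubles the size in constant time. The size of the
-- output therefore needs a bound of its own before programs can be composed.
record Feasible : Set where
  field
    computation : Computation
    polynomial  : Polynomial
  open Computation computation public
  field
    bound : ∀ x → time x + size (fun x) ≤ eval polynomial (size x)

  time-bound : ∀ x → time x ≤ eval polynomial (size x)
  time-bound x = ≤-trans (m≤m+n _ _) (bound x)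

  size-bound : ∀ x → size (fun x) ≤ eval polynomial (size x)
  size-bound x = ≤-trans (m≤n+m _ _) (bound x)

size-head : ∀ t → size (head t) ≤ size t
size-head nil     = ≤-refl
size-head (a ∙ b) = m≤n⇒m≤1+n (m≤m+n _ _)

size-tail : ∀ t → size (tail t) ≤ size t
size-tail nil     = ≤-refl
size-tail (a ∙ b) = m≤n⇒m≤1+n (m≤n+m _ _)

size-branch : ∀ b y z → size (branch b y z) ≤ size y + size z
size-branch nil     y z = m≤n+m _ _
size-branch (_ ∙ _) y z = m≤m+n _ _

-- Polynomial-time programs on lists

module Feasibles where
  open Feasible
  open Computations

  idᶠ nilᶠ hdᶠ tlᶠ : Feasible
  idᶠ  = record { computation = idᶜ ; polynomial = con 1 ⊕ X ; bound = λ _ → ≤-refl }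
  nilᶠ = record { computation = nilᶜ ; polynomial = con 2 ; bound = λ _ → ≤-refl }
  hdᶠ  = record { computation = hdᶜ ; polynomial = con 1 ⊕ X ; bound = λ x → s≤s (size-head x) }
  tlᶠ  = record { computation = tlᶜ ; polynomial = con 1 ⊕ X ; bound = λ x → s≤s (size-tail x) }

  infixr 6 _⨾ᶠ_
  consᶠ _⨾ᶠ_ : Feasible → Feasible → Feasible
  consᶠ p q = record
    { computation = consᶜ (computation p) (computation q)
    ; polynomial  = con 1 ⊕ (polynomial p ⊕ polynomial q) ⊕ (con 1 ⊕ (polynomial p ⊕ polynomial q))
    ; bound       = λ x → +-mono-≤ (s≤s (+-mono-≤ (time-bound p x) (time-bound q x)))
                                   (s≤s (+-mono-≤ (size-bound p x) (size-bound q x)))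
    }
  p ⨾ᶠ q = record
    { computation = seqᶜ (computation p) (computation q)
    ; polynomial  = con 1 ⊕ (polynomial p ⊕ polynomial q ⊚ polynomial p) ⊕ polynomial q ⊚ polynomial p
    ; bound       = λ x →
        let size≤ = eval-mono (polynomial q) (size-bound p x) in
        +-mono-≤ (s≤s (+-mono-≤ (time-bound p x) (≤-trans (time-bound q (fun p x)) size≤)))
                 (≤-trans (size-bound q (fun p x)) size≤)
    }

  ifᶠ : Feasible → Feasible → Feasible → Feasible
  ifᶠ b p q = record
    { computation = ifᶜ (computation b) (computation p) (computation q)
    ; polynomial  = con 1 ⊕ (polynomial b ⊕ (polynomial p ⊕ polynomial q)) ⊕ (polynomial p ⊕ polynomial q)
    ; bound       = λ x →
        +-mono-≤ (≤-trans (branchTime≤ (computation b) (computation p) (computation q) x)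
                   (s≤s (+-mono-≤ (time-bound b x) (+-mono-≤ (time-bound p x) (time-bound q x)))))
                 (≤-trans (size-branch (fun b x) _ _) (+-mono-≤ (size-bound p x) (size-bound q x)))
    }

  reverseTime≤ : ∀ t → reverseTime t ≤ 11 * size t
  reverseTime≤ nil     = s≤s (s≤s z≤n)
  reverseTime≤ (a ∙ b) = begin
    11 + reverseTime b   ≤⟨ +-monoʳ-≤ 11 (reverseTime≤ b) ⟩
    11 + 11 * size b     ≡⟨ *-suc 11 (size b) ⟨
    11 * suc (size b)    ≤⟨ *-monoʳ-≤ 11 (s≤s (m≤n+m (size b) (size a))) ⟩
    11 * size (a ∙ b)    ∎
    where open ≤-Reasoning

  module _ (l z s : Feasible) where
    private module F = Fold (computation l) (computation z) (computation s)
    value = F.value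

    -- A fold whose step doubles its value is exponential, however cheap the step. A fold is
    -- feasible once all intermediate values obey one polynomial `q`.
    module _ (q : Polynomial)
             (value-bound : ∀ x t → size (value x t) ≤ eval q (size t + size x)) where
      private
        P = polynomial
        stateP stepP : Polynomial
        stateP = con 1 ⊕ P l ⊕ (con 1 ⊕ (q ⊚ (P l ⊕ X) ⊕ X))
        -- 16 is the cost of an iteration apart from `s`: 14 for the rest of the body, 1 for the
        -- test and 1 for `again`.
        stepP  = con 16 ⊕ P s ⊚ stateP

        loopTime≤ : ∀ x t u → size t ≤ eval (P l) (size x) →
          F.loopTime x t u ≤ size t * eval stepP (size x) + u
        loopTime≤ x nil     u t≤ = m≤n+m u _
        loopTime≤ x (e ∙ t) u t≤ = begin
          F.loopTime x t (suc (1 + F.bodyTime c + u))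
            ≤⟨ loopTime≤ x t _ (≤-trans (size-tail (e ∙ t)) t≤) ⟩
          size t * B + (suc (1 + F.bodyTime c + u))
            ≡⟨ cong (λ k → size t * B + k) (cong (_+ u) bodyTime≡) ⟩
          size t * B + (16 + c + u)
            ≤⟨ +-monoʳ-≤ (size t * B) (+-monoˡ-≤ u (+-monoʳ-≤ 16 c≤)) ⟩
          size t * B + (B + u)
            ≡⟨ +-assoc (size t * B) B u ⟨
          size t * B + B + u
            ≡⟨ cong (_+ u) (+-comm (size t * B) B) ⟩
          suc (size t) * B + u
            ≤⟨ +-monoˡ-≤ u (*-monoˡ-≤ B (s≤s (m≤n+m (size t) (size e)))) ⟩
          size (e ∙ t) * B + u  ∎
          where
          open ≤-Reasoning
          B = eval stepP (size x)
          c = time s (e ∙ value x t ∙ x)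
          bodyTime≡ : suc (1 + F.bodyTime c) ≡ 16 + c
          bodyTime≡ = cong (13 +_) (+-comm c 3)
          c≤ : c ≤ eval (P s ⊚ stateP) (size x)
          c≤ = ≤-trans (time-bound s _) (eval-mono (P s)
                 (s≤s (+-mono-≤ (≤-trans (size-head (e ∙ t)) t≤)
                        (s≤s (+-monoˡ-≤ (size x) (≤-trans (value-bound x t)
                          (eval-mono q (+-monoˡ-≤ (size x) (≤-trans (size-tail (e ∙ t)) t≤)))))))))

      foldᶠ : Feasible
      foldᶠ = record
        { computation = foldᶜ (computation l) (computation z) (computation s)
        ; polynomial  =
            con 1 ⊕ (con 1 ⊕ (con 1 ⊕ (P l ⊕ (con 5 ⊕ (con 11 ⊗ P l ⊕ con 1)))
                              ⊕ (con 1 ⊕ (P z ⊕ con 1)))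
                     ⊕ (con 1 ⊕ (P l ⊗ stepP ⊕ con 2 ⊕ con 3)))
            ⊕ q ⊚ (P l ⊕ X)
        ; bound       = λ x →
            +-mono-≤
              (s≤s (+-mono-≤
                (s≤s (+-mono-≤
                  (s≤s (+-mono-≤ (time-bound l x)
                    (+-monoʳ-≤ 5 (+-monoˡ-≤ 1 (≤-trans (reverseTime≤ (fun l x)) (*-monoʳ-≤ 11 (size-bound l x)))))))
                  (s≤s (+-monoˡ-≤ 1 (time-bound z x)))))
                (s≤s (+-monoˡ-≤ 3 (≤-trans (loopTime≤ x (fun l x) 2 (size-bound l x))
                  (+-monoˡ-≤ 2 (*-monoˡ-≤ (eval stepP (size x)) (size-bound l x))))))))
              (≤-trans (value-bound x (fun l x)) (eval-mono q (+-monoˡ-≤ (size x) (size-bound l x))))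
        }

  -- Variables: the input is a list, and the body of a loop is run on the
  -- current element prepended to it.
  # : ℕ → Feasible
  # zero    = hdᶠ
  # (suc i) = tlᶠ ⨾ᶠ # i

  literalᶠ : Tree → Feasible
  literalᶠ nil     = nilᶠ
  literalᶠ (a ∙ b) = consᶠ (literalᶠ a) (literalᶠ b)

  -- The test of `greedyᶠ` sees the element, the selection so far and the input; `filterᶠ` hides the
  -- selection from it. `dropᶠ a b` shortens the list of `b` by the length of the list of `a`:
  -- subtraction of unary numbers.
  mapᶠ greedyᶠ filterᶠ dropᶠ : Feasible → Feasible → Feasible

  mapᶠ l b = foldᶠ l nilᶠ step (con 1 ⊕ X ⊗ (con 1 ⊕ polynomial b ⊚ X)) value-bound
    where
    -- The accumulated value is cut out of the state, so that `b` runs on the element prepended to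
    -- the input.
    step = consᶠ (consᶠ hdᶠ (tlᶠ ⨾ᶠ tlᶠ) ⨾ᶠ b) (tlᶠ ⨾ᶠ hdᶠ)
    value-bound : ∀ x t → size (value l nilᶠ step x t) ≤
                  suc ((size t + size x) * suc (eval (polynomial b) (size t + size x)))
    value-bound x t = ≤-trans (go t ≤-refl) (s≤s (*-monoˡ-≤ _ (m≤m+n (size t) (size x))))
      where
      B = suc (eval (polynomial b) (size t + size x))
      go : ∀ t′ → size t′ ≤ size t → size (value l nilᶠ step x t′) ≤ suc (size t′ * B)
      go nil      _  = s≤s z≤n
      go (e ∙ t′) ≤t = s≤s (begin
        size (fun b (e ∙ x)) + size (value l nilᶠ step x t′)
          ≤⟨ +-mono-≤ (≤-trans (size-bound b (e ∙ x)) (eval-mono (polynomial b)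
                        (+-monoˡ-≤ (size x) (≤-trans (s≤s (m≤m+n (size e) (size t′))) ≤t))))
                      (go t′ (≤-trans (size-tail (e ∙ t′)) ≤t)) ⟩
        eval (polynomial b) (size t + size x) + suc (size t′ * B)
          ≡⟨ +-suc _ _ ⟩
        B + size t′ * B
          ≤⟨ *-monoˡ-≤ B (s≤s (m≤n+m (size t′) (size e))) ⟩
        size (e ∙ t′) * B ∎)
        where open ≤-Reasoning

  greedyᶠ l b = foldᶠ l nilᶠ step X value-bound
    where
    step = ifᶠ b (consᶠ hdᶠ (tlᶠ ⨾ᶠ hdᶠ)) (tlᶠ ⨾ᶠ hdᶠ)
    go : ∀ x t → size (value l nilᶠ step x t) ≤ size t
    go x nil     = ≤-refl
    go x (e ∙ t) with fun b (e ∙ value l nilᶠ step x t ∙ x)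
    ... | nil   = ≤-trans (go x t) (size-tail (e ∙ t))
    ... | _ ∙ _ = s≤s (+-monoʳ-≤ (size e) (go x t))
    value-bound : ∀ x t → size (value l nilᶠ step x t) ≤ size t + size x
    value-bound x t = ≤-trans (go x t) (m≤m+n _ _)

  filterᶠ l b = greedyᶠ l (consᶠ hdᶠ (tlᶠ ⨾ᶠ tlᶠ) ⨾ᶠ b)

  dropᶠ a b = foldᶠ a b step (polynomial b) value-bound
    where
    step = tlᶠ ⨾ᶠ hdᶠ ⨾ᶠ tlᶠ
    go : ∀ x t → size (value a b step x t) ≤ size (fun b x)
    go x nil     = ≤-refl
    go x (e ∙ t) = ≤-trans (size-tail (value a b step x t)) (go x t)
    value-bound : ∀ x t → size (value a b step x t) ≤ eval (polynomial b) (size t + size x)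
    value-bound x t =
      ≤-trans (go x t) (≤-trans (size-bound b x) (eval-mono (polynomial b) (m≤n+m _ _)))

-- Computable numerical functions

module _ where
  open Computation
  open Computations

  Computes : Computation → (ℕ → ℕ) → Set
  Computes c f = ∀ n → fun c (numeral n) ≡ numeral (f n)

  computes⇒computable : ∀ c {f} → Computes c f → Computable f
  computes⇒computable c spec = prog c , λ n →
    time c (numeral n) ,
    subst (λ y → prog c ⊢ numeral n ⇓ y cost time c (numeral n)) (spec n) (runs c (numeral n))

  constantᶜ : ℕ → Computation
  constantᶜ k = literalᶜ (numeral k)

  literal-spec : ∀ t x → fun (literalᶜ t) x ≡ t
  literal-spec nil     x = refl
  literal-spec (a ∙ b) x = cong₂ _∙_ (literal-spec a x) (literal-spec b x)

  plusᶜ timesᶜ : Computation → Computation → Computation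
  plusᶜ a b  = foldᶜ a b (consᶜ nilᶜ (seqᶜ tlᶜ hdᶜ))
  timesᶜ a b = foldᶜ a nilᶜ (plusᶜ (seqᶜ tlᶜ (seqᶜ tlᶜ b)) (seqᶜ tlᶜ hdᶜ))

  -- The output is exponential, which `Computable` permits: it asks for a run without limiting its
  -- length. Hence a `Computation` and not a `Feasible`.
  powerOfTwoᶜ : Computation → Computation
  powerOfTwoᶜ a = foldᶜ a (constantᶜ 1) (plusᶜ (seqᶜ tlᶜ hdᶜ) (seqᶜ tlᶜ hdᶜ))

  plus-spec : ∀ a b x {m n} → fun a x ≡ numeral m → fun b x ≡ numeral n →
    fun (plusᶜ a b) x ≡ numeral (m + n)
  plus-spec a b x {m} {n} a≡ b≡ rewrite a≡ | b≡ = go m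
    where
    go : ∀ m → foldTree (λ _ → nil ∙_) (numeral n) (numeral m) ≡ numeral (m + n)
    go zero    = refl
    go (suc m) = cong (nil ∙_) (go m)

  times-spec : ∀ a b x {m n} → fun a x ≡ numeral m → fun b x ≡ numeral n →
    fun (timesᶜ a b) x ≡ numeral (m * n)
  times-spec a b x {m} {n} a≡ b≡ rewrite a≡ = go m
    where
    add = plusᶜ (seqᶜ tlᶜ (seqᶜ tlᶜ b)) (seqᶜ tlᶜ hdᶜ)
    go : ∀ m → foldTree (λ e t → fun add (e ∙ t ∙ x)) nil (numeral m) ≡ numeral (m * n)
    go zero    = refl
    go (suc m) = plus-spec (seqᶜ tlᶜ (seqᶜ tlᶜ b)) (seqᶜ tlᶜ hdᶜ) (nil ∙ _ ∙ x) b≡ (go m)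

  powerOfTwo-spec : ∀ a x {m} → fun a x ≡ numeral m → fun (powerOfTwoᶜ a) x ≡ numeral (2 ^ m)
  powerOfTwo-spec a x {m} a≡ rewrite a≡ = go m
    where
    double = plusᶜ (seqᶜ tlᶜ hdᶜ) (seqᶜ tlᶜ hdᶜ)
    go : ∀ m → foldTree (λ e t → fun double (e ∙ t ∙ x)) (numeral 1) (numeral m) ≡ numeral (2 ^ m)
    go zero    = refl
    go (suc m) = trans
      (plus-spec (seqᶜ tlᶜ hdᶜ) (seqᶜ tlᶜ hdᶜ) (nil ∙ _ ∙ x) (go m) (go m))
      (cong (λ k → numeral (2 ^ m + k)) (sym (+-identityʳ (2 ^ m))))

  polynomialᶜ : Polynomial → Computation
  polynomialᶜ X       = idᶜ
  polynomialᶜ (con c) = constantᶜ c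
  polynomialᶜ (p ⊕ q) = plusᶜ (polynomialᶜ p) (polynomialᶜ q)
  polynomialᶜ (p ⊗ q) = timesᶜ (polynomialᶜ p) (polynomialᶜ q)
  polynomialᶜ (p ⊚ q) = seqᶜ (polynomialᶜ q) (polynomialᶜ p)

  polynomial-spec : ∀ p → Computes (polynomialᶜ p) (eval p)
  polynomial-spec X       n = refl
  polynomial-spec (con c) n = literal-spec (numeral c) (numeral n)
  polynomial-spec (p ⊕ q) n =
    plus-spec (polynomialᶜ p) (polynomialᶜ q) (numeral n) (polynomial-spec p n) (polynomial-spec q n)
  polynomial-spec (p ⊗ q) n =
    times-spec (polynomialᶜ p) (polynomialᶜ q) (numeral n) (polynomial-spec p n) (polynomial-spec q n)
  polynomial-spec (p ⊚ q) n =
    trans (cong (fun (polynomialᶜ p)) (polynomial-spec q n)) (polynomial-spec p (eval q n))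

  orderBound : ℕ → ℕ
  orderBound p = p + p * 2 ^ p

  orderBoundᶜ : Computation
  orderBoundᶜ = plusᶜ idᶜ (timesᶜ idᶜ (powerOfTwoᶜ idᶜ))

  orderBound-spec : Computes orderBoundᶜ orderBound
  orderBound-spec n = plus-spec idᶜ (timesᶜ idᶜ (powerOfTwoᶜ idᶜ)) (numeral n) refl
    (times-spec idᶜ (powerOfTwoᶜ idᶜ) (numeral n) refl (powerOfTwo-spec idᶜ (numeral n) refl))

  computable-orderBound : ∀ p → Computable (eval p ∘ orderBound)
  computable-orderBound p = computes⇒computable (seqᶜ orderBoundᶜ (polynomialᶜ p)) λ n →
    trans (cong (fun (polynomialᶜ p)) (orderBound-spec n)) (polynomial-spec p (orderBound n))

open Feasible
open Feasibles

-- Greedy selection, and list programs with their specifications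

module _ {A : Set} {P : A → List A → Set} (P? : ∀ x ys → Dec (P x ys)) where
  -- The end of the list is decided first, as in a right fold, and each element is judged against
  -- the selection made behind it. Both the kept twins and the leaves of the stars arise in this
  -- way.
  greedy : List A → List A
  greedy []       = []
  greedy (x ∷ xs) = Bool.if does (P? x (greedy xs)) then x ∷ greedy xs else greedy xs

truth : Tree → Bool
truth nil     = false
truth (_ ∙ _) = true

truth-encodeBool : ∀ b → truth (encodeBool b) ≡ b
truth-encodeBool false = refl
truth-encodeBool true  = refl

spine : Tree → ℕ
spine nil     = 0
spine (_ ∙ t) = suc (spine t)

spine-encodeList : ∀ ts → spine (encodeList ts) ≡ length ts
spine-encodeList []       = refl
spine-encodeList (t ∷ ts) = cong suc (spine-encodeList ts)

spine-numeral : ∀ n → spine (numeral n) ≡ n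
spine-numeral zero    = refl
spine-numeral (suc n) = cong suc (spine-numeral n)

tails : ℕ → Tree → Tree
tails zero    t = t
tails (suc n) t = tail (tails n t)

tails-tail : ∀ n t → tails n (tail t) ≡ tail (tails n t)
tails-tail zero    t = refl
tails-tail (suc n) t = cong tail (tails-tail n t)

spine-tails : ∀ n t → spine (tails n t) ≡ spine t ∸ n
spine-tails zero    t = refl
spine-tails (suc n) t = begin
  spine (tail (tails n t))   ≡⟨ spine-tail (tails n t) ⟩
  spine (tails n t) ∸ 1      ≡⟨ cong (_∸ 1) (spine-tails n t) ⟩
  spine t ∸ n ∸ 1            ≡⟨ ∸-+-assoc (spine t) n 1 ⟩
  spine t ∸ (n + 1)          ≡⟨ cong (spine t ∸_) (+-comm n 1) ⟩
  spine t ∸ suc n            ∎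
  where
  open ≡-Reasoning
  spine-tail : ∀ t → spine (tail t) ≡ spine t ∸ 1
  spine-tail nil     = refl
  spine-tail (_ ∙ t) = refl

numerals : ℕ → Tree
numerals n = encodeList (map numeral (downFrom n))

size-numeral : ∀ n → size (numeral n) ≡ 1 + 2 * n
size-numeral zero    = refl
size-numeral (suc n) = cong suc (trans (cong suc (size-numeral n)) (sym (*-suc 2 n)))

spine≤size : ∀ t → spine t ≤ size t
spine≤size nil     = z≤n
spine≤size (a ∙ t) = s≤s (≤-trans (spine≤size t) (m≤n+m _ _))

size-encodeList : ∀ {B ts} → All (λ t → size t ≤ B) ts →
  size (encodeList ts) ≤ 1 + length ts * (1 + B)
size-encodeList []       = s≤s z≤n
size-encodeList {B} {t ∷ ts} (t≤ ∷ ts≤) = s≤s (begin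
  size t + size (encodeList ts)      ≤⟨ +-mono-≤ t≤ (size-encodeList ts≤) ⟩
  B + (1 + length ts * (1 + B))      ≡⟨ +-suc B _ ⟩
  length (t ∷ ts) * (1 + B)          ∎)
  where open ≤-Reasoning

size-numerals : ∀ n → size (numerals n) ≤ 1 + n * (1 + (1 + 2 * n))
size-numerals n = subst (λ k → size (numerals n) ≤ 1 + k * (1 + (1 + 2 * n)))
  (trans (length-map numeral (downFrom n)) (length-downFrom n))
  (size-encodeList (All.map⁺ (small n ≤-refl)))
  where
  small : ∀ m → m ≤ n → All (λ i → size (numeral i) ≤ 1 + 2 * n) (downFrom m)
  small zero    _   = []
  small (suc m) m<n =
    ≤-trans (≤-reflexive (size-numeral m)) (s≤s (*-monoʳ-≤ 2 (<⇒≤ m<n))) ∷ small m (<⇒≤ m<n)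

trueᶠ : Feasible
trueᶠ = consᶠ nilᶠ nilᶠ

notᶠ : Feasible → Feasible
notᶠ b = ifᶠ b nilᶠ trueᶠ

-- Truth is nonemptiness, so that a filter answers an existential question and a drop compares
-- lengths. In `truncateᶠ`, the inner drop produces a list as long as the part to be removed, which
-- leaves at most the length of `m`.
andᶠ orᶠ allᶠ leqᶠ eqᶠ iffᶠ atᶠ truncateᶠ memberᶠ : Feasible → Feasible → Feasible
andᶠ b c      = ifᶠ b c nilᶠ
orᶠ b c       = ifᶠ b trueᶠ c
allᶠ l b      = notᶠ (filterᶠ l (notᶠ b))
leqᶠ a b      = notᶠ (dropᶠ b a)
eqᶠ a b       = andᶠ (leqᶠ a b) (leqᶠ b a)
iffᶠ b c      = ifᶠ b c (notᶠ c)
atᶠ l i       = dropᶠ i l ⨾ᶠ hdᶠ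
truncateᶠ m l = dropᶠ (dropᶠ m l) l
memberᶠ v l   = filterᶠ l (eqᶠ (tlᶠ ⨾ᶠ v) hdᶠ)

private
  prependPositionᶠ : Feasible
  -- The positions are generated downwards: the new head is the successor of the previous one. To
  -- start, `trueᶠ` yields `nil ∙ nil`, which is also the list containing only the numeral 0.
  prependPositionᶠ = ifᶠ (# 1) (consᶠ (consᶠ nilᶠ (# 1 ⨾ᶠ hdᶠ)) (# 1)) trueᶠ

  positions-value : ∀ l x t → value l nilᶠ prependPositionᶠ x t ≡ numerals (spine t)
  positions-value l x nil     = refl
  positions-value l x (e ∙ t) rewrite positions-value l x t with spine t
  ... | zero  = refl
  ... | suc n = refl

positionsᶠ : Feasible → Feasible
positionsᶠ l =
  foldᶠ l nilᶠ prependPositionᶠ (con 1 ⊕ X ⊗ (con 1 ⊕ (con 1 ⊕ con 2 ⊗ X))) value-bound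
  where
  value-bound : ∀ x t → size (value l nilᶠ prependPositionᶠ x t) ≤
                1 + (size t + size x) * (1 + (1 + 2 * (size t + size x)))
  value-bound x t rewrite positions-value l x t = ≤-trans (size-numerals (spine t))
    (s≤s (*-mono-≤ spine≤ (s≤s (s≤s (*-monoʳ-≤ 2 spine≤)))))
    where
    spine≤ : spine t ≤ size t + size x
    spine≤ = ≤-trans (spine≤size t) (m≤m+n _ _)

positions-spec : ∀ l x → fun (positionsᶠ l) x ≡ numerals (spine (fun l x))
positions-spec l x = positions-value l x (fun l x)

module _ {A B : Set} {α : A → Tree} {β : B → Tree} where
  map-spec : ∀ l b x xs {f : A → B} → fun l x ≡ encodeList (map α xs) →
    (∀ a → fun b (α a ∙ x) ≡ β (f a)) → fun (mapᶠ l b) x ≡ encodeList (map (β ∘ f) xs)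
  map-spec l b x xs l≡ b≡ rewrite l≡ = go xs
    where
    go : ∀ xs → foldTree (λ e a → fun b (e ∙ x) ∙ a) nil (encodeList (map α xs)) ≡ encodeList (map _ xs)
    go []       = refl
    go (a ∷ xs) = cong₂ _∙_ (b≡ a) (go xs)

module _ {A : Set} {α : A → Tree} where
  greedy-spec : ∀ {P : A → List A → Set} {P? : ∀ a ys → Dec (P a ys)} l b x xs →
    fun l x ≡ encodeList (map α xs) →
    (∀ a ys → truth (fun b (α a ∙ encodeList (map α ys) ∙ x)) ≡ does (P? a ys)) →
    fun (greedyᶠ l b) x ≡ encodeList (map α (greedy P? xs))
  greedy-spec {P? = P?} l b x xs l≡ b≡ rewrite l≡ = go xs
    where
    go : ∀ xs → foldTree (λ e a → branch (fun b (e ∙ a ∙ x)) (e ∙ a) a) nil (encodeList (map α xs))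
         ≡ encodeList (map α (greedy P? xs))
    go []       = refl
    go (a ∷ xs) rewrite go xs
      with fun b (α a ∙ encodeList (map α (greedy P? xs)) ∙ x) | does (P? a (greedy P? xs)) | b≡ a (greedy P? xs)
    ... | nil   | false | _ = refl
    ... | _ ∙ _ | true  | _ = refl

  module _ {P : Pred A 0ℓ} {P? : Decidable P} where
    filter-spec : ∀ l b x xs → fun l x ≡ encodeList (map α xs) →
      (∀ a → truth (fun b (α a ∙ x)) ≡ does (P? a)) →
      fun (filterᶠ l b) x ≡ encodeList (map α (filter P? xs))
    filter-spec l b x xs l≡ b≡ rewrite l≡ = go xs
      where
      go : ∀ xs → foldTree (λ e a → branch (fun b (e ∙ x)) (e ∙ a) a) nil (encodeList (map α xs))
           ≡ encodeList (map α (filter P? xs))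
      go []       = refl
      go (a ∷ xs) with fun b (α a ∙ x) | does (P? a) | b≡ a
      ... | nil   | false | _ = go xs
      ... | _ ∙ _ | true  | _ = cong (α a ∙_) (go xs)

    any-spec : ∀ l b x xs → fun l x ≡ encodeList (map α xs) →
      (∀ a → truth (fun b (α a ∙ x)) ≡ does (P? a)) →
      truth (fun (filterᶠ l b) x) ≡ does (Any.any? P? xs)
    any-spec l b x xs l≡ b≡ = trans (cong truth (filter-spec l b x xs l≡ b≡)) (go xs)
      where
      go : ∀ xs → truth (encodeList (map α (filter P? xs))) ≡ does (Any.any? P? xs)
      go []       = refl
      go (a ∷ xs) with does (P? a)
      ... | true  = refl
      ... | false = go xs

not-spec : ∀ b x → truth (fun (notᶠ b) x) ≡ not (truth (fun b x))
not-spec b x with fun b x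
... | nil   = refl
... | _ ∙ _ = refl

and-spec : ∀ b c x → truth (fun (andᶠ b c) x) ≡ truth (fun b x) ∧ truth (fun c x)
and-spec b c x with fun b x
... | nil   = refl
... | _ ∙ _ = refl

or-spec : ∀ b c x → truth (fun (orᶠ b c) x) ≡ truth (fun b x) ∨ truth (fun c x)
or-spec b c x with fun b x
... | nil   = refl
... | _ ∙ _ = refl

iff-spec : ∀ b c x → truth (fun (iffᶠ b c) x) ≡ does (truth (fun b x) Bool.≟ truth (fun c x))
iff-spec b c x with fun b x | fun c x
... | nil   | nil   = refl
... | nil   | _ ∙ _ = refl
... | _ ∙ _ | nil   = refl
... | _ ∙ _ | _ ∙ _ = refl

all-spec : ∀ {A : Set} {α : A → Tree} {P : Pred A 0ℓ} {P? : Decidable P} l b x xs →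
  fun l x ≡ encodeList (map α xs) → (∀ a → truth (fun b (α a ∙ x)) ≡ does (P? a)) →
  truth (fun (allᶠ l b) x) ≡ does (All.all? P? xs)
all-spec {α = α} {P? = P?} l b x xs l≡ b≡ = begin
  truth (fun (allᶠ l b) x)
    ≡⟨ not-spec (filterᶠ l (notᶠ b)) x ⟩
  not (truth (fun (filterᶠ l (notᶠ b)) x))
    ≡⟨ cong not (any-spec {P? = ¬? ∘ P?} l (notᶠ b) x xs l≡
                   (λ a → trans (not-spec b (α a ∙ x)) (cong not (b≡ a)))) ⟩
  not (does (Any.any? (¬? ∘ P?) xs))
    ≡⟨ go xs ⟩
  does (All.all? P? xs) ∎
  where
  open ≡-Reasoning
  go : ∀ xs → not (does (Any.any? (¬? ∘ P?) xs)) ≡ does (All.all? P? xs)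
  go []       = refl
  go (a ∷ xs) with does (P? a)
  ... | true  = go xs
  ... | false = refl

drop-spec : ∀ a b x → fun (dropᶠ a b) x ≡ tails (spine (fun a x)) (fun b x)
drop-spec a b x = go (fun a x)
  where
  go : ∀ t → foldTree (λ _ → tail) (fun b x) t ≡ tails (spine t) (fun b x)
  go nil     = refl
  go (_ ∙ t) = cong tail (go t)

leq-spec : ∀ a b x → truth (fun (leqᶠ a b) x) ≡ does (spine (fun a x) ≤? spine (fun b x))
leq-spec a b x = begin
  truth (fun (leqᶠ a b) x)              ≡⟨ not-spec (dropᶠ b a) x ⟩
  not (truth (fun (dropᶠ b a) x))       ≡⟨ cong (not ∘ truth) (drop-spec b a x) ⟩
  not (truth (tails n (fun a x)))       ≡⟨ zero-spine (tails n (fun a x)) ⟩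
  does (spine (tails n (fun a x)) ≤? 0) ≡⟨ cong (λ k → does (k ≤? 0)) (spine-tails n (fun a x)) ⟩
  does (m ∸ n ≤? 0)                     ≡⟨ does-⇔ (mk⇔ (m∸n≡0⇒m≤n ∘ n≤0⇒n≡0) (≤-reflexive ∘ m≤n⇒m∸n≡0))
                                            (m ∸ n ≤? 0) (m ≤? n) ⟩
  does (m ≤? n)                         ∎
  where
  open ≡-Reasoning
  m = spine (fun a x)
  n = spine (fun b x)
  zero-spine : ∀ t → not (truth t) ≡ does (spine t ≤? 0)
  zero-spine nil     = refl
  zero-spine (_ ∙ t) = refl

eq-spec : ∀ {n} a b x {u v : Fin n} →
  fun a x ≡ numeral (toℕ u) → fun b x ≡ numeral (toℕ v) →
  truth (fun (eqᶠ a b) x) ≡ does (u Fin.≟ v)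
eq-spec a b x {u} {v} a≡ b≡ = begin
  truth (fun (eqᶠ a b) x)
    ≡⟨ and-spec (leqᶠ a b) (leqᶠ b a) x ⟩
  truth (fun (leqᶠ a b) x) ∧ truth (fun (leqᶠ b a) x)
    ≡⟨ cong₂ _∧_ (leq-spec a b x) (leq-spec b a x) ⟩
  does (spine (fun a x) ≤? spine (fun b x)) ∧ does (spine (fun b x) ≤? spine (fun a x))
    ≡⟨ cong₂ (λ i j → does (i ≤? j) ∧ does (j ≤? i))
         (trans (cong spine a≡) (spine-numeral (toℕ u))) (trans (cong spine b≡) (spine-numeral (toℕ v))) ⟩
  does ((toℕ u ≤? toℕ v) ×-dec (toℕ v ≤? toℕ u))
    ≡⟨ does-⇔ (mk⇔ (λ (p , q) → Fin.toℕ-injective (≤-antisym p q)) λ { refl → ≤-refl , ≤-refl })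
         ((toℕ u ≤? toℕ v) ×-dec (toℕ v ≤? toℕ u)) (u Fin.≟ v) ⟩
  does (u Fin.≟ v) ∎
  where open ≡-Reasoning

at-spec : ∀ {n} l i x (f : Fin n → Tree) v →
  fun l x ≡ encodeList (toList f) → fun i x ≡ numeral (toℕ v) → fun (atᶠ l i) x ≡ f v
at-spec l i x f v l≡ i≡ = begin
  head (fun (dropᶠ i l) x)                           ≡⟨ cong head (drop-spec i l x) ⟩
  head (tails (spine (fun i x)) (fun l x))           ≡⟨ cong₂ (λ k t → head (tails k t))
                                                              (trans (cong spine i≡) (spine-numeral (toℕ v))) l≡ ⟩
  head (tails (toℕ v) (encodeList (toList f)))       ≡⟨ go f v ⟩
  f v                                                ∎
  where
  open ≡-Reasoning
  go : ∀ {n} (f : Fin n → Tree) v → head (tails (toℕ v) (encodeList (toList f))) ≡ f v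
  go f zero    = refl
  go f (suc v) = trans (cong head (sym (tails-tail (toℕ v) _))) (go (f ∘ suc) v)

member-spec : ∀ {n} v l x (u : Fin n) us → fun v x ≡ numeral (toℕ u) →
  fun l x ≡ encodeList (map (numeral ∘ toℕ) us) →
  truth (fun (memberᶠ v l) x) ≡ does (_∈?_ Fin._≟_ u us)
member-spec v l x u us v≡ l≡ =
  any-spec l (eqᶠ (tlᶠ ⨾ᶠ v) hdᶠ) x us l≡ λ w → eq-spec (tlᶠ ⨾ᶠ v) hdᶠ (numeral (toℕ w) ∙ x) v≡ refl

-- Vertex lists, walks and paths

vertexList : ∀ n → List (Fin n)
vertexList zero    = []
vertexList (suc n) = fromℕ n ∷ map inject₁ (vertexList n)

map-toℕ-vertexList : ∀ n → map toℕ (vertexList n) ≡ downFrom n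
map-toℕ-vertexList zero    = refl
map-toℕ-vertexList (suc n) = cong₂ _∷_ (Fin.toℕ-fromℕ n) (begin
  map toℕ (map inject₁ (vertexList n))   ≡⟨ map-∘ (vertexList n) ⟨
  map (toℕ ∘ inject₁) (vertexList n)     ≡⟨ map-cong Fin.toℕ-inject₁ (vertexList n) ⟩
  map toℕ (vertexList n)                 ≡⟨ map-toℕ-vertexList n ⟩
  downFrom n                             ∎)
  where open ≡-Reasoning

vertexList-unique : ∀ n → Unique (vertexList n)
vertexList-unique n = Unique.map⁻ (subst Unique (sym (map-toℕ-vertexList n)) (Unique.downFrom⁺ n))

∈-vertexList : ∀ {n} (v : Fin n) → v ∈ vertexList n
∈-vertexList {suc n} v with v Fin.≟ fromℕ n
... | yes v≡n = here v≡n
... | no  v≢n =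
  there (subst (_∈ _) (Fin.inject₁-lower₁ v n≢v) (∈-map⁺ inject₁ (∈-vertexList (lower₁ v n≢v))))
  where
  n≢v : n ≢ toℕ v
  n≢v n≡v = v≢n (Fin.toℕ-injective (trans (sym n≡v) (sym (Fin.toℕ-fromℕ n))))

-- The order of the list matters: `greedy` and the choice of neighbours depend on it, so the program
-- has to run through the vertices in the same descending order.
encodeList-numerals : ∀ n → numerals n ≡ encodeList (map (numeral ∘ toℕ) (vertexList n))
encodeList-numerals n = cong encodeList (trans (cong (map numeral) (sym (map-toℕ-vertexList n))) (sym (map-∘ (vertexList n))))

lookup-injective : ∀ {A : Set} {xs : List A} → Unique xs → ∀ {i j} → lookup xs i ≡ lookup xs j → i ≡ j
lookup-injective {xs = _ ∷ _} _        {zero}  {zero}  _ = refl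
lookup-injective {xs = _ ∷ xs} (x∉ ∷ _) {zero}  {suc j} x≡ = contradiction x≡ (All.lookup x∉ (∈-lookup j))
lookup-injective {xs = _ ∷ xs} (x∉ ∷ _) {suc i} {zero}  x≡ = contradiction (sym x≡) (All.lookup x∉ (∈-lookup i))
lookup-injective {xs = _ ∷ _} (_ ∷ xs!) {suc i} {suc j} eq = cong suc (lookup-injective xs! eq)

unique⇒length≤ : ∀ {n} {xs : List (Fin n)} → Unique xs → length xs ≤ n
unique⇒length≤ xs! = Fin.injective⇒≤ (lookup-injective xs!)

restrict : ∀ {m n} → (Fin m → Fin n) → Graph n → Graph m
restrict ι G = record
  { adj    = λ u v → adj (ι u) (ι v)
  ; symm   = λ u v → symm (ι u) (ι v)
  ; irrefl = λ v → irrefl (ι v)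
  }
  where open Graph G

mapWalk : ∀ {m n} {G : Graph m} {H : Graph n} (f : Fin m → Fin n) →
  (∀ {u v} → Graph.Adj G u v → Graph.Adj H (f u) (f v)) →
  ∀ {u v ℓ} → Graph.Walk G u v ℓ → Graph.Walk H (f u) (f v) ℓ
mapWalk f hom Graph.[]      = Graph.[]
mapWalk f hom (e Graph.∷ w) = hom e Graph.∷ mapWalk f hom w

vertices-mapWalk : ∀ {m n} {G : Graph m} {H : Graph n} (f : Fin m → Fin n)
  (hom : ∀ {u v} → Graph.Adj G u v → Graph.Adj H (f u) (f v)) →
  ∀ {u v ℓ} (w : Graph.Walk G u v ℓ) →
  Graph.vertices H (mapWalk {H = H} f hom w) ≡ map f (Graph.vertices G w)
vertices-mapWalk f hom Graph.[]      = refl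
vertices-mapWalk f hom (e Graph.∷ w) = cong (f _ ∷_) (vertices-mapWalk f hom w)

walk-zero : ∀ {n} {G : Graph n} {u v} → Graph.Walk G u v 0 → u ≡ v
walk-zero Graph.[] = refl

module GraphProperties {n} (G : Graph n) where
  open Graph G

  Twin : Fin n → Fin n → Set
  Twin u v = ∀ x → adj u x ≡ adj v x

  Twin-sym : ∀ {u v} → Twin u v → Twin v u
  Twin-sym u~v x = sym (u~v x)

  Twin-trans : ∀ {u v w} → Twin u v → Twin v w → Twin u w
  Twin-trans u~v v~w x = trans (u~v x) (v~w x)

  Adj-sym : ∀ {u v} → Adj u v → Adj v u
  Adj-sym {u} {v} = subst T (symm u v)

  Adj-irrefl : ∀ {v} → ¬ Adj v v
  Adj-irrefl {v} = subst T (irrefl v)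

  Adj-twinˡ : ∀ {u u′ v} → Twin u u′ → Adj u v → Adj u′ v
  Adj-twinˡ {v = v} u~u′ = subst T (u~u′ v)

  Adj-twinʳ : ∀ {u v v′} → Twin v v′ → Adj u v → Adj u v′
  Adj-twinʳ v~v′ = Adj-sym ∘ Adj-twinˡ v~v′ ∘ Adj-sym

  -- The last edge may lead to either twin. An empty walk has no last edge, hence the positive
  -- length; this exception is what forces the shadow to be unoccupied.
  replaceEnd : ∀ {u v v′ ℓ} → Twin v v′ → Walk u v (suc ℓ) → Walk u v′ (suc ℓ)
  replaceEnd v~v′ (e ∷ [])        = Adj-twinʳ v~v′ e ∷ []
  replaceEnd v~v′ (e ∷ w@(_ ∷ _)) = e ∷ replaceEnd v~v′ w

  -- The field `inside` lets a property of all vertices of a walk, such as being unguarded, pass to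
  -- the path obtained from it.
  record PathWithin (S : List (Fin n)) (u v : Fin n) (d : ℕ) : Set where
    field
      {ℓ}     : ℕ
      path    : Walk u v ℓ
      isPath  : IsPath path
      length≤ : ℓ ≤ d
      inside  : vertices path ⊆ S

  length-vertices : ∀ {u v ℓ} (w : Walk u v ℓ) → length (vertices w) ≡ suc ℓ
  length-vertices []      = refl
  length-vertices (_ ∷ w) = cong suc (length-vertices w)

  suffix : ∀ {u v ℓ x} (w : Walk u v ℓ) → IsPath w → x ∈ vertices w → PathWithin (vertices w) x v ℓ
  suffix []      w! (here refl) = record { path = [] ; isPath = w! ; length≤ = ≤-refl ; inside = λ z → z }
  suffix (e ∷ w) w! (here refl) = record { path = e ∷ w ; isPath = w! ; length≤ = ≤-refl ; inside = λ z → z }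
  suffix (e ∷ w) (_ ∷ w!) (there x∈) = record
    { path = path ; isPath = isPath ; length≤ = m≤n⇒m≤1+n length≤ ; inside = there ∘ inside }
    where open PathWithin (suffix w w! x∈)

  eraseLoops : ∀ {u v ℓ} (w : Walk u v ℓ) → PathWithin (vertices w) u v ℓ
  eraseLoops []      = record { path = [] ; isPath = [] ∷ [] ; length≤ = z≤n ; inside = λ z → z }
  eraseLoops {u} (e ∷ w) with eraseLoops w
  ... | p with _∈?_ Fin._≟_ u (vertices (PathWithin.path p))
  ... | yes u∈ = record
    { path = S.path ; isPath = S.isPath ; length≤ = m≤n⇒m≤1+n (≤-trans S.length≤ P.length≤)
    ; inside = there ∘ P.inside ∘ S.inside }
    where
    module P = PathWithin p
    module S = PathWithin (suffix P.path P.isPath u∈)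
  ... | no u∉ = record
    { path = e ∷ P.path ; isPath = All.¬Any⇒All¬ _ u∉ ∷ P.isPath ; length≤ = s≤s P.length≤
    ; inside = λ { (here eq) → here eq ; (there x∈) → there (P.inside x∈) } }
    where module P = PathWithin p

  path-length : ∀ {u v ℓ} (w : Walk u v ℓ) → IsPath w → ℓ < n
  path-length w w! = subst (_≤ n) (length-vertices w) (unique⇒length≤ w!)

-- False twins

module Retraction
  (I : Instance) {m} (ι : Fin m → Fin (Instance.order I))
  (ι-injective : ∀ {s t} → ι s ≡ ι t → s ≡ t)
  (ρ : Fin (Instance.order I) → Fin m)
  (ρ-twin : ∀ v → GraphProperties.Twin (Instance.graph I) v (ι (ρ v)))
  (ρ-ι : ∀ s → ρ (ι s) ≡ s)
  where

  open Instance I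
  open Graph graph using (Adj; adj)
  open GraphProperties graph
  private
    module G = Graph graph
    H = restrict ι graph
    module H = Graph H

  ι-hom : ∀ {s t} → H.Adj s t → G.Adj (ι s) (ι t)
  ι-hom e = e

  ρ-hom : ∀ {u v} → G.Adj u v → H.Adj (ρ u) (ρ v)
  ρ-hom {u} {v} e = Adj-twinˡ (ρ-twin u) (Adj-twinʳ (ρ-twin v) e)

  ιWalk : ∀ {s t ℓ} → H.Walk s t ℓ → G.Walk (ι s) (ι t) ℓ
  ιWalk = mapWalk ι ι-hom

  ρWalk : ∀ {u v ℓ} → G.Walk u v ℓ → H.Walk (ρ u) (ρ v) ℓ
  ρWalk = mapWalk ρ ρ-hom

  restricted : Instance
  restricted = record
    { order     = m
    ; graph     = H
    ; connected = λ s t → let (ℓ , w) = connected (ι s) (ι t) in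
                  ℓ , subst₂ (λ a b → H.Walk a b ℓ) (ρ-ι s) (ρ-ι t) (ρWalk w)
    ; #cops     = #cops
    ; cops      = cops
    ; robber    = robber
    }

  private
    module GI = Game I
    module GJ = Game restricted

  ρ-guarded : ∀ {c s} → GI.Guarded c (ι s) → GJ.Guarded (ρ ∘ c) s
  ρ-guarded {c} {s} (i , ℓ , ℓ≤ , w) = i , ℓ , ℓ≤ , subst (λ t → H.Walk (ρ (c i)) t ℓ) (ρ-ι s) (ρWalk w)

  ρ-copMove : ∀ {c c′} → GI.CopMove c c′ → GJ.CopMove (ρ ∘ c) (ρ ∘ c′)
  ρ-copMove move = record
    { withinSpeed = λ i → let (ℓ , ℓ≤ , w) = withinSpeed i in ℓ , ℓ≤ , ρWalk w
    ; activeMove  = λ i active → ρ-hom (activeMove i active)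
    ; oneLazy     = λ i j lazyᵢ lazyⱼ i≢ j≢ →
        oneLazy i j lazyᵢ lazyⱼ (i≢ ∘ cong ρ) (j≢ ∘ cong ρ)
    }
    where open GI.CopMove move

  ι-robberMove : ∀ {c s s′} → GJ.RobberMove (ρ ∘ c) s s′ → GI.RobberMove c (ι s) (ι s′)
  ι-robberMove {c} move = record
    { walk       = ιWalk walk
    ; isPath     = subst Unique (sym vertices≡) (Unique.map⁺ ι-injective isPath)
    ; length≤    = length≤
    ; unguarded  = subst (All _) (sym vertices≡) (All.map⁺ (All.map (λ ¬g g → ¬g (ρ-guarded {c} g)) unguarded))
    ; activeMove = activeMove
    }
    where
    open GJ.RobberMove move
    vertices≡ : G.vertices (ιWalk walk) ≡ map ι (H.vertices walk)
    vertices≡ = vertices-mapWalk ι ι-hom walk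

  -- The cops play the images under `ρ`, a homomorphism that fixes the kept vertices. It does not
  -- increase distances, so what is unguarded in the small graph was unguarded in the large one, and
  -- the robber's moves lift along `ι`. This direction works for any number of kept twins.
  ρ-strategy : ∀ {c s} → GI.WinningStrategy c (ι s) → GJ.WinningStrategy (ρ ∘ c) s
  ρ-strategy (GI.capture c′ move g)    = GJ.capture (ρ ∘ c′) (ρ-copMove move) (ρ-guarded {c′} g)
  ρ-strategy (GI.continue c′ move win) =
    GJ.continue (ρ ∘ c′) (ρ-copMove move) λ s′ move′ → ρ-strategy (win (ι s′) (ι-robberMove {c′} move′))

  win⇒win-restricted : GI.CopsWin → GJ.CopsWin
  win⇒win-restricted (c , win) = ρ ∘ c , λ s ¬g → ρ-strategy (win (ι s) (¬g ∘ ρ-guarded {c}))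

  -- The robber of the large graph is shadowed by an unoccupied twin of his
  -- vertex.  The shadow is guarded only if he is, as a twin is reached by every
  -- nonempty walk that reaches the shadow.
  Free : (Fin #cops → Fin m) → Fin m → Set
  Free c s = ∀ i → c i ≢ s

  module Shadow
    (free : ∀ c v → (∀ i → ι (c i) ≢ v) → ∃[ s ] Twin v (ι s) × Free c s) where

    shadow-guarded : ∀ {c r s} → Twin r (ι s) → Free c s → GJ.Guarded c s → GI.Guarded (ι ∘ c) r
    shadow-guarded r~s c≢s (i , zero  , ℓ≤ , Graph.[]) = contradiction refl (c≢s i)
    shadow-guarded r~s c≢s (i , suc ℓ , ℓ≤ , w) = i , suc ℓ , ℓ≤ , replaceEnd (Twin-sym r~s) (ιWalk w)

    unguarded⇒free : ∀ {c v} → ¬ GI.Guarded (ι ∘ c) v → ∃[ s ] Twin v (ι s) × Free c s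
    unguarded⇒free {c} {v} ¬g = free c v λ { i refl → ¬g (i , 0 , z≤n , Graph.[]) }

    ι-copMove : ∀ {c c′} → GJ.CopMove c c′ → GI.CopMove (ι ∘ c) (ι ∘ c′)
    ι-copMove move = record
      { withinSpeed = λ i → let (ℓ , ℓ≤ , w) = withinSpeed i in ℓ , ℓ≤ , ιWalk w
      ; activeMove  = activeMove
      ; oneLazy     = λ i j lazyᵢ lazyⱼ i≢ j≢ → oneLazy i j lazyᵢ lazyⱼ (i≢ ∘ cong ι) (j≢ ∘ cong ι)
      }
      where open GJ.CopMove move

    shadowWalk : ∀ {c r r′ ℓ s} (w : G.Walk r r′ ℓ) → Twin r (ι s) → Free c s →
      All (λ v → ¬ GI.Guarded (ι ∘ c) v) (G.vertices w) →
      ∃[ s′ ] Twin r′ (ι s′) × Free c s′ ×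
        (Σ[ w′ ∈ H.Walk s s′ ℓ ] All (λ v → ¬ GJ.Guarded c v) (H.vertices w′))
    shadowWalk {c} {s = s} Graph.[] r~s c≢s (¬g ∷ []) =
      s , r~s , c≢s , Graph.[] , (¬g ∘ shadow-guarded {c} r~s c≢s) ∷ []
    shadowWalk {c} (e Graph.∷ w) r~s c≢s (¬g ∷ ¬gs) =
      let (t , v~t , c≢t)            = unguarded⇒free {c} (head¬ w ¬gs)
          (s′ , r′~s′ , c≢s′ , w′ , ¬gs′) = shadowWalk w v~t c≢t ¬gs
      in s′ , r′~s′ , c≢s′ , Adj-twinˡ r~s (Adj-twinʳ v~t e) Graph.∷ w′ ,
         (¬g ∘ shadow-guarded {c} r~s c≢s) ∷ ¬gs′
      where
      head¬ : ∀ {u v ℓ} {P : Fin order → Set} (w : G.Walk u v ℓ) → All P (G.vertices w) → P u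
      head¬ Graph.[]      (p ∷ _) = p
      head¬ (_ Graph.∷ _) (p ∷ _) = p

    -- Distinct twins on the robber's path may receive the same shadow, so the shadow walk need not
    -- be a path. Erasing its loops keeps the ends, shortens it and visits no new vertex.
    shadowMove : ∀ {c r r′ s} → Twin r (ι s) → Free c s → GI.RobberMove (ι ∘ c) r r′ →
      ∃[ s′ ] Twin r′ (ι s′) × Free c s′ × GJ.RobberMove c s s′
    shadowMove {c} r~s c≢s move =
      let (s′ , r′~s′ , c≢s′ , w′ , ¬gs) = shadowWalk {c} walk r~s c≢s unguarded
          module P = GraphProperties.PathWithin (GraphProperties.eraseLoops H w′)
      in s′ , r′~s′ , c≢s′ , record
        { walk       = P.path
        ; isPath     = P.isPath
        ; length≤    = ≤-trans P.length≤ length≤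
        ; unguarded  = All.tabulate (All.lookup ¬gs ∘ P.inside)
        ; activeMove = λ active → Adj-twinˡ r~s (Adj-twinʳ r′~s′ (activeMove active))
        }
      where open GI.RobberMove move

    -- A cop that would land on the shadow moves to the robber instead.
    landOnRobber : ∀ {c c′ r s} → Twin r (ι s) → Free c s → GJ.CopMove c c′ →
      ∀ i → c′ i ≡ s → GI.WinningStrategy (ι ∘ c) r
    landOnRobber {c} {c′} {r} {s} r~s c≢s move i c′i≡s = GI.capture d record
      { withinSpeed = within
      ; activeMove  = adjacent
      ; oneLazy     = λ j k lazyⱼ lazyₖ j≢ k≢ → oneLazy j k lazyⱼ lazyₖ (moved j j≢) (moved k k≢)
      } (i , 0 , z≤n , subst (λ v → G.Walk v r 0) (sym di≡r) Graph.[])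
      where
      open GJ.CopMove move
      d : GI.Positions
      d j = Bool.if does (j Fin.≟ i) then r else ι (c′ j)
      di≡r : d i ≡ r
      di≡r with i Fin.≟ i
      ... | yes _  = refl
      ... | no i≢i = contradiction refl i≢i
      s~r : Twin (ι s) r
      s~r = Twin-sym r~s
      within : ∀ j → G.Within (Cop.speed (cops j)) (ι (c j)) (d j)
      within j with j Fin.≟ i | withinSpeed j
      ... | no _     | ℓ , ℓ≤ , w = ℓ , ℓ≤ , ιWalk w
      -- A cop that does not move would have stood on the shadow before, which was free.
      ... | yes refl | zero , ℓ≤ , w = contradiction (trans (walk-zero w) c′i≡s) (c≢s i)
      ... | yes refl | suc ℓ , ℓ≤ , w =
        suc ℓ , ℓ≤ , replaceEnd s~r (ιWalk (subst (λ t → H.Walk (c i) t (suc ℓ)) c′i≡s w))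
      adjacent : ∀ j → Cop.mode (cops j) ≡ CopMode.active → G.Adj (ι (c j)) (d j)
      adjacent j eq with j Fin.≟ i
      ... | no _     = activeMove j eq
      ... | yes refl = Adj-twinʳ s~r (subst (H.Adj (c i)) c′i≡s (activeMove i eq))
      -- The redirected cop already moved in the small graph, since it did not start on the shadow.
      -- Thus no new lazy cop moves.
      moved : ∀ j → ι (c j) ≢ d j → c j ≢ c′ j
      moved j j≢ with j Fin.≟ i
      ... | no _     = j≢ ∘ cong ι
      ... | yes refl = λ eq → c≢s i (trans eq c′i≡s)

    shadow-strategy : ∀ {c r s} → Twin r (ι s) → Free c s →
      GJ.WinningStrategy c s → GI.WinningStrategy (ι ∘ c) r
    -- At distance 0 the cop stands on the shadow itself, and its walk does not transfer to the
    -- robber's vertex.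
    shadow-strategy r~s c≢s (GJ.capture c′ move (i , zero , ℓ≤ , Graph.[])) =
      landOnRobber r~s c≢s move i refl
    shadow-strategy r~s c≢s (GJ.capture c′ move (i , suc ℓ , ℓ≤ , w)) =
      GI.capture (ι ∘ c′) (ι-copMove move) (i , suc ℓ , ℓ≤ , replaceEnd (Twin-sym r~s) (ιWalk w))
    -- A strategy may also continue with a cop on the shadow. The shadow would then no longer be
    -- free for the next round, but the robber can be captured at once.
    shadow-strategy {s = s} r~s c≢s (GJ.continue c′ move win) with Fin.any? (λ i → c′ i Fin.≟ s)
    ... | yes (i , c′i≡s) = landOnRobber r~s c≢s move i c′i≡s
    ... | no  c′≢s        = GI.continue (ι ∘ c′) (ι-copMove move) λ r′ move′ →
      let (s′ , r′~s′ , c′≢s′ , move″) = shadowMove r~s (λ i eq → c′≢s (i , eq)) move′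
      in shadow-strategy r′~s′ c′≢s′ (win s′ move″)

    win-restricted⇒win : GJ.CopsWin → GI.CopsWin
    win-restricted⇒win (c , win) = ι ∘ c , λ r ¬g →
      let (s , r~s , c≢s) = unguarded⇒free {c} ¬g
      in shadow-strategy r~s c≢s (win s (¬g ∘ shadow-guarded {c} r~s c≢s))

-- Large speeds and reaches

-- Two numbers that are equal, or both too large to differ in a graph of order n.
Similar : ℕ → ℕ → ℕ → Set
Similar n s s′ = s ≡ s′ ⊎ (n ≤ s × n ≤ s′)

Similar-sym : ∀ {n s s′} → Similar n s s′ → Similar n s′ s
Similar-sym (inj₁ eq)        = inj₁ (sym eq)
Similar-sym (inj₂ (n≤ , n≤′)) = inj₂ (n≤′ , n≤)

Similar-≤ : ∀ {n s s′ ℓ} → Similar n s s′ → ℓ < n → ℓ ≤ s → ℓ ≤ s′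
Similar-≤ (inj₁ refl)      ℓ<n ℓ≤ = ℓ≤
Similar-≤ (inj₂ (_ , n≤′)) ℓ<n ℓ≤ = ≤-trans (<⇒≤ ℓ<n) n≤′

-- Without loops, a walk has fewer than `n` edges, and below `n` similar bounds agree.
Within-similar : ∀ {n} (G : Graph n) {s s′ u v} → Similar n s s′ → Graph.Within G s u v → Graph.Within G s′ u v
Within-similar G sim (_ , ℓ≤ , w) =
  P.ℓ , Similar-≤ sim (path-length P.path P.isPath) (≤-trans P.length≤ ℓ≤) , P.path
  where
  open GraphProperties G
  module P = PathWithin (eraseLoops w)

SimilarCop : ℕ → Cop → Cop → Set
SimilarCop n C C′ = Cop.mode C ≡ Cop.mode C′ ×
  Similar n (Cop.speed C) (Cop.speed C′) × Similar n (Cop.reach C) (Cop.reach C′)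

SimilarCop-sym : ∀ {n C C′} → SimilarCop n C C′ → SimilarCop n C′ C
SimilarCop-sym (mode≡ , speed , reach) = sym mode≡ , Similar-sym speed , Similar-sym reach

SimilarRobber : ℕ → Robber → Robber → Set
SimilarRobber n R R′ = Robber.mode R ≡ Robber.mode R′ × Similar n (Robber.speed R) (Robber.speed R′)

SimilarRobber-sym : ∀ {n R R′} → SimilarRobber n R R′ → SimilarRobber n R′ R
SimilarRobber-sym (mode≡ , speed) = sym mode≡ , Similar-sym speed

withAgents : (I : Instance) → Vector Cop (Instance.#cops I) → Robber → Instance
withAgents I cops robber = record
  { order = order ; graph = graph ; connected = connected ; #cops = #cops ; cops = cops ; robber = robber }
  where open Instance I using (order; graph; connected; #cops)

-- The cops keep their placement and all their moves: speeds and reaches matter only through the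
-- lengths of walks, which may be taken below the order.
win-similar : ∀ I {cops cops′ robber robber′} →
  (∀ i → SimilarCop (Instance.order I) (cops i) (cops′ i)) →
  SimilarRobber (Instance.order I) robber robber′ →
  Game.CopsWin (withAgents I cops robber) → Game.CopsWin (withAgents I cops′ robber′)
win-similar I {cops} {cops′} {robber} {robber′} simC simR (c , win) =
  c , λ r ¬g → strategy (win r (¬g ∘ guarded {c}))
  where
  open Instance I using (graph)
  module A = Game (withAgents I cops robber)
  module B = Game (withAgents I cops′ robber′)

  guarded : ∀ {c v} → A.Guarded c v → B.Guarded c v
  guarded (i , w) = i , Within-similar graph (proj₂ (proj₂ (simC i))) w

  copMove : ∀ {c c′} → A.CopMove c c′ → B.CopMove c c′
  copMove move = record
    { withinSpeed = λ i → Within-similar graph (proj₁ (proj₂ (simC i))) (withinSpeed i)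
    ; activeMove  = λ i eq → activeMove i (trans (proj₁ (simC i)) eq)
    ; oneLazy     = λ i j eqᵢ eqⱼ → oneLazy i j (trans (proj₁ (simC i)) eqᵢ) (trans (proj₁ (simC j)) eqⱼ)
    }
    where open A.CopMove move

  robberMove : ∀ {c r r′} → B.RobberMove c r r′ → A.RobberMove c r r′
  robberMove {c} move = record
    { walk       = walk
    ; isPath     = isPath
    ; length≤    = Similar-≤ (Similar-sym (proj₂ simR)) (GraphProperties.path-length graph walk isPath) length≤
    ; unguarded  = All.map (_∘ guarded {c}) unguarded
    ; activeMove = λ eq → activeMove (trans (sym (proj₁ simR)) eq)
    }
    where open B.RobberMove move

  strategy : ∀ {c r} → A.WinningStrategy c r → B.WinningStrategy c r
  strategy (A.capture c′ move g)    = B.capture c′ (copMove move) (guarded {c′} g)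
  strategy (A.continue c′ move win) = B.continue c′ (copMove move) λ r′ move′ → strategy (win r′ (robberMove {c′} move′))

-- Greedy selections, and enumerations of subsets

module _ {A : Set} {P : A → List A → Set} (P? : ∀ x ys → Dec (P x ys)) where
  greedy-⊆ : ∀ xs → greedy P? xs ⊆ xs
  greedy-⊆ (x ∷ xs) y∈ with P? x (greedy P? xs) | y∈
  ... | yes _ | here eq  = here eq
  ... | yes _ | there y∈ = there (greedy-⊆ xs y∈)
  ... | no  _ | y∈       = there (greedy-⊆ xs y∈)

  greedy-unique : ∀ {xs} → Unique xs → Unique (greedy P? xs)
  greedy-unique []         = []
  greedy-unique {x ∷ xs} (x∉ ∷ xs!) with P? x (greedy P? xs)
  ... | yes _ = All.tabulate (All.lookup x∉ ∘ greedy-⊆ xs) ∷ greedy-unique xs!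
  ... | no  _ = greedy-unique xs!

  greedy-invariant : (Q : List A → Set) → Q [] → (∀ {x ys} → P x ys → Q ys → Q (x ∷ ys)) →
    ∀ xs → Q (greedy P? xs)
  greedy-invariant Q q[] q∷ []       = q[]
  greedy-invariant Q q[] q∷ (x ∷ xs) with P? x (greedy P? xs)
  ... | yes p = q∷ p (greedy-invariant Q q[] q∷ xs)
  ... | no  _ = greedy-invariant Q q[] q∷ xs

  -- `ys` is the selection at the moment `v` was refused, and the selection has only grown since.
  -- For the twins this yields many kept ones; for the stars it shows that no further vertex can
  -- join the leaves.
  greedy-rejected : ∀ {xs v} → Unique xs → v ∈ xs → v ∉ greedy P? xs →
    ∃[ ys ] ys ⊆ greedy P? xs × Unique ys × ¬ P v ys
  greedy-rejected {x ∷ xs} (_ ∷ xs!) v∈ v∉ with P? x (greedy P? xs) | v∈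
  ... | yes _ | here refl = contradiction (here refl) v∉
  ... | yes _ | there v∈′ =
    let (ys , ys⊆ , ys! , ¬p) = greedy-rejected xs! v∈′ (v∉ ∘ there) in ys , there ∘ ys⊆ , ys! , ¬p
  ... | no ¬p | here refl = greedy P? xs , (λ z → z) , greedy-unique xs! , ¬p
  ... | no _  | there v∈′ = greedy-rejected xs! v∈′ v∉

subset-elements : ∀ {n} (U : Subset n) →
  Σ[ e ∈ (Fin ∣ U ∣ → Fin n) ] (∀ {u} → u Subset.∈ U → ∃[ i ] e i ≡ u)
subset-elements []          = (λ ()) , λ ()
subset-elements (false ∷ U) =
  let (e , onto) = subset-elements U in
  suc ∘ e , λ { (there u∈) → let (i , eq) = onto u∈ in i , cong suc eq }
subset-elements (true ∷ U)  =
  let (e , onto) = subset-elements U in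
  (λ { zero → zero ; (suc i) → suc (e i) }) ,
  λ { here → zero , refl ; (there u∈) → let (i , eq) = onto u∈ in suc i , cong suc eq }

-- Every vertex v outside a set D contributes the edge from v to its chosen
-- neighbour.  When D is maximal such that these edges cover all vertices, they
-- form a spanning star forest with |D| stars: there is a matching of size |D|,
-- and the centres of the stars are a dominating set.
module Stars {n} (G : Graph n) (neighbour : Fin n → Fin n) where
  open Graph G
  open GraphProperties G using (Adj-sym; Adj-irrefl)

  Covered : List (Fin n) → Fin n → Set
  Covered D u = Any (λ v → v ∉ D × (u ≡ v ⊎ u ≡ neighbour v)) (vertexList n)

  Covers : List (Fin n) → Set
  Covers D = All (Covered D) (vertexList n)

  covered? : ∀ D u → Dec (Covered D u)
  covered? D u =
    Any.any? (λ v → ¬? (_∈?_ Fin._≟_ v D) ×-dec (u Fin.≟ v ⊎-dec u Fin.≟ neighbour v)) (vertexList n)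

  covers? : ∀ D → Dec (Covers D)
  covers? D = All.all? (covered? D) (vertexList n)

  covers-with? : ∀ v D → Dec (Covers (v ∷ D))
  covers-with? v D = covers? (v ∷ D)

  leaves : List (Fin n)
  leaves = greedy covers-with? (vertexList n)

  private
    D = leaves
    _∈D? : ∀ v → Dec (v ∈ D)
    v ∈D? = _∈?_ Fin._≟_ v D

  leaves-unique : Unique D
  leaves-unique = greedy-unique covers-with? (vertexList-unique n)

  covered : ∀ u → ∃[ v ] v ∉ D × (u ≡ v ⊎ u ≡ neighbour v)
  covered u = Any.satisfied (All.lookup
    (greedy-invariant covers-with? Covers
      (All.tabulate λ {u} _ → Any.map (λ { refl → (λ ()) , inj₁ refl }) (∈-vertexList u))
      (λ p _ → p) (vertexList n))
    (∈-vertexList u))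

  partner : ∀ {u} → u ∈ D → ∃[ v ] v ∉ D × u ≡ neighbour v
  partner {u} u∈ with covered u
  ... | v , v∉ , inj₁ refl = contradiction u∈ v∉
  ... | v , v∉ , inj₂ eq   = v , v∉ , eq

  module _ (adjacent : ∀ v → Adj v (neighbour v)) where
    -- If both ends of the edge of `v` lay in other edges, everything would stay covered without it,
    -- and `v` would have been selected. Here `z` takes care of the end `v`, so no other `y` can
    -- take care of the end `neighbour v`.
    essential : ∀ {v y z} → v ∉ D → z ∉ D → v ≡ neighbour z →
      y ∉ D → y ≢ v → ¬ (neighbour v ≡ y ⊎ neighbour v ≡ neighbour y)
    essential {v} {y} {z} v∉ z∉ v≡fz y∉ y≢v fv∈y =
      let (ys , ys⊆ , _ , ¬cover) = greedy-rejected covers-with? (vertexList-unique n) (∈-vertexList v) v∉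
      in ¬cover (All.tabulate λ {u} _ → cover ys⊆ u (covered u))
      where
      z≢v : z ≢ v
      z≢v refl = Adj-irrefl (subst (Adj v) (sym v≡fz) (adjacent v))
      found : ∀ {ys u x} → ys ⊆ D → x ∉ D → x ≢ v → u ≡ x ⊎ u ≡ neighbour x → Covered (v ∷ ys) u
      found {x = x} ys⊆ x∉ x≢v u∈x = Any.map
        (λ { refl → (λ { (here eq) → x≢v eq ; (there x∈) → x∉ (ys⊆ x∈) }) , u∈x }) (∈-vertexList x)
      cover : ∀ {ys} → ys ⊆ D → ∀ u → (∃[ x ] x ∉ D × (u ≡ x ⊎ u ≡ neighbour x)) → Covered (v ∷ ys) u
      cover ys⊆ u (x , x∉ , u∈x) with x Fin.≟ v | u∈x
      ... | no  x≢v  | _         = found ys⊆ x∉ x≢v u∈x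
      ... | yes refl | inj₁ refl = found ys⊆ z∉ z≢v (inj₂ v≡fz)
      ... | yes refl | inj₂ refl = found ys⊆ y∉ y≢v fv∈y

    -- The star of a leaf u consists of the edges with one of these ends x.
    InStar : Fin n → Fin n → Set
    InStar u x = x ≡ u ⊎ (x ∉ D × neighbour x ≡ u)
               ⊎ (x ∉ D × neighbour x ∉ D × neighbour (neighbour x) ≡ u)

    -- Following `neighbour` reaches `D` within two steps. Otherwise the second of three consecutive
    -- edges would have both ends in the other two.
    inStar : ∀ x → ∃[ u ] u ∈ D × InStar u x
    inStar x with x ∈D?
    ... | yes x∈ = x , x∈ , inj₁ refl
    ... | no  x∉ with neighbour x ∈D?
    ... | yes w∈ = neighbour x , w∈ , inj₂ (inj₁ (x∉ , refl))
    ... | no  w∉ with neighbour (neighbour x) ∈D?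
    ... | yes u∈ = neighbour (neighbour x) , u∈ , inj₂ (inj₂ (x∉ , w∉ , refl))
    ... | no  u∉ = ⊥-elim (essential w∉ x∉ refl u∉
            (λ eq → Adj-irrefl (subst (Adj _) eq (adjacent (neighbour x)))) (inj₁ refl))

    -- Let the edge of `v` end in `u`. If some other edge ends in `v`, then `v` is the centre and
    -- `u` only a leaf; if none does, `u` is the centre. A vertex of the star not adjacent to the
    -- centre would make an edge redundant, against `essential`.
    centre : ∀ {u} → u ∈ D → ∃[ g ] (∀ x → InStar u x → g ≡ x ⊎ Adj g x)
    centre {u} u∈ with partner u∈
    ... | v , v∉ , refl with Fin.any? (λ z → ¬? (z ∈D?) ×-dec (v Fin.≟ neighbour z))
    ... | yes (z , z∉ , v≡fz) = v , dominates
      where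
      dominates : ∀ x → InStar (neighbour v) x → v ≡ x ⊎ Adj v x
      dominates x (inj₁ refl) = inj₂ (adjacent v)
      dominates x (inj₂ (inj₁ (x∉ , fx≡u))) with x Fin.≟ v
      ... | yes x≡v = inj₁ (sym x≡v)
      ... | no  x≢v = ⊥-elim (essential v∉ z∉ v≡fz x∉ x≢v (inj₂ (sym fx≡u)))
      dominates x (inj₂ (inj₂ (x∉ , w∉ , fw≡u))) with v Fin.≟ neighbour x
      ... | yes refl = inj₂ (Adj-sym (adjacent x))
      ... | no  v≢w  = ⊥-elim (essential w∉ x∉ refl v∉ v≢w (inj₂ fw≡u))
    ... | no ∄z = neighbour v , dominates
      where
      dominates : ∀ x → InStar (neighbour v) x → neighbour v ≡ x ⊎ Adj (neighbour v) x
      dominates x (inj₁ refl) = inj₁ refl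
      dominates x (inj₂ (inj₁ (x∉ , fx≡u))) = inj₂ (subst (λ u → Adj u x) fx≡u (Adj-sym (adjacent x)))
      dominates x (inj₂ (inj₂ (x∉ , w∉ , fw≡u))) with v Fin.≟ neighbour x
      ... | yes v≡w = contradiction (x , x∉ , v≡w) ∄z
      ... | no  v≢w = ⊥-elim (essential w∉ x∉ refl v∉ v≢w (inj₂ fw≡u))

    -- Each `u` in `D` is matched to a partner outside `D` whose chosen neighbour is `u`. These
    -- edges are disjoint: an end in `D` is `u` itself, and an end outside determines `u` through
    -- `neighbour`. The cover contains an end of each.
    leaves≤cover : ∀ U → VertexCover U → length D ≤ ∣ U ∣
    leaves≤cover U cover = Fin.injective⇒≤ {f = index} index-injective
      where
      e = proj₁ (subset-elements U)
      onto = proj₂ (subset-elements U)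
      End : Fin n → Fin n → Set
      End u w = w ≡ u ⊎ (w ∉ D × u ≡ neighbour w)
      end : ∀ {u} → u ∈ D → ∃[ w ] w Subset.∈ U × End u w
      end {u} u∈ with u Subset.∈? U | partner u∈
      ... | yes u∈U | _ = u , u∈U , inj₁ refl
      ... | no  u∉U | w , w∉ , refl with w Subset.∈? U
      ... | yes w∈U = w , w∈U , inj₂ (w∉ , refl)
      ... | no  w∉U = contradiction (adjacent w) (cover w u w∉U u∉U)
      End-injective : ∀ {u u′ w} → u ∈ D → u′ ∈ D → End u w → End u′ w → u ≡ u′
      End-injective u∈ u′∈ (inj₁ refl)     (inj₁ refl)      = refl
      End-injective u∈ u′∈ (inj₁ refl)     (inj₂ (w∉ , _))  = contradiction u∈ w∉
      End-injective u∈ u′∈ (inj₂ (w∉ , _)) (inj₁ refl)      = contradiction u′∈ w∉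
      End-injective u∈ u′∈ (inj₂ (_ , eq)) (inj₂ (_ , eq′)) = trans eq (sym eq′)
      index : Fin (length D) → Fin ∣ U ∣
      index j = let (w , w∈U , _) = end (∈-lookup j) in proj₁ (onto w∈U)
      index-injective : ∀ {i j} → index i ≡ index j → i ≡ j
      index-injective {i} {j} eq =
        let (w , w∈U , u-w)    = end (∈-lookup {xs = D} i)
            (w′ , w′∈U , u′-w′) = end (∈-lookup {xs = D} j)
            w≡w′ = trans (sym (proj₂ (onto w∈U))) (trans (cong e eq) (proj₂ (onto w′∈U)))
        in lookup-injective leaves-unique
             (End-injective (∈-lookup i) (∈-lookup j) u-w (subst (End (lookup D j)) (sym w≡w′) u′-w′))

-- Winning from a dominating set

module Dominating (I : Instance) (neighbour : Fin (Instance.order I) → Fin (Instance.order I))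
  (adjacent : ∀ v → Graph.Adj (Instance.graph I) v (neighbour v)) where
  open Instance I
  open Graph graph
  open Game I

  -- One cop steps onto the robber, active cops step to any neighbour and all others stay. Hence
  -- only the capturing cop can be a lazy cop that moves.
  dominated⇒win : (c : Positions) → (∀ r → ∃[ i ] (c i ≡ r ⊎ Adj (c i) r)) → CopsWin
  dominated⇒win c dominated = c , win
    where
    step : CopMode → Vertex → Vertex
    step active v = neighbour v
    step _      v = v
    step-within : ∀ m v {s} → 0 < s → Within s v (step m v)
    step-within active   v s>0 = 1 , s>0 , adjacent v ∷ []
    step-within lazy     v s>0 = 0 , z≤n , []
    step-within flexible v s>0 = 0 , z≤n , []
    win : ∀ r → ¬ Guarded c r → WinningStrategy c r
    win r ¬g with dominated r
    ... | i , inj₁ refl = contradiction (i , 0 , z≤n , []) ¬g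
    ... | i , inj₂ e    = capture d record
      { withinSpeed = within
      ; activeMove  = active-adjacent
      ; oneLazy     = λ j k lⱼ lₖ j≢ k≢ → trans (only j lⱼ j≢) (sym (only k lₖ k≢))
      }
      (i , 0 , z≤n , subst (λ v → Walk v r 0) (sym di≡r) [])
      where
      d : Positions
      d j = Bool.if does (j Fin.≟ i) then r else step (Cop.mode (cops j)) (c j)
      di≡r : d i ≡ r
      di≡r with i Fin.≟ i
      ... | yes _  = refl
      ... | no i≢i = contradiction refl i≢i
      within : ∀ j → Within (Cop.speed (cops j)) (c j) (d j)
      within j with j Fin.≟ i
      ... | yes refl = 1 , Cop.speed>0 (cops i) , e ∷ []
      ... | no  _    = step-within (Cop.mode (cops j)) (c j) (Cop.speed>0 (cops j))
      active-adjacent : ∀ j → Cop.mode (cops j) ≡ active → Adj (c j) (d j)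
      active-adjacent j eq with j Fin.≟ i
      ... | yes refl = e
      ... | no  _    = subst (λ m → Adj (c j) (step m (c j))) (sym eq) (adjacent (c j))
      only : ∀ j → Cop.mode (cops j) ≡ lazy → c j ≢ d j → j ≡ i
      only j eq c≢d with j Fin.≟ i
      ... | yes j≡i = j≡i
      ... | no  _   = contradiction (cong (λ m → step m (c j)) (sym eq)) c≢d

  open Stars graph neighbour

  stars⇒win : length leaves ≤ #cops → Vertex → CopsWin
  stars⇒win leaves≤ v₀ = dominated⇒win c λ r →
    let (u , u∈ , u-r) = inStar adjacent r
        j = Any.index u∈
    in inject≤ j leaves≤ , subst (λ v → v ≡ r ⊎ Adj v r) (sym (c-inject≤ j))
         (proj₂ (centre adjacent (∈-lookup j)) r (subst (λ u → InStar adjacent u r) (Any.lookup-index u∈) u-r))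
    where
    centreAt : Fin (length leaves) → Vertex
    centreAt j = proj₁ (centre adjacent (∈-lookup j))
    c : Positions
    c i with toℕ i <? length leaves
    ... | yes i< = centreAt (fromℕ< i<)
    -- Cops in excess of the stars may stand anywhere.
    ... | no  _  = v₀
    c-inject≤ : ∀ j → c (inject≤ j leaves≤) ≡ centreAt j
    c-inject≤ j with toℕ (inject≤ j leaves≤) <? length leaves
    ... | yes i< = cong centreAt (Fin.toℕ-injective (trans (Fin.toℕ-fromℕ< i<) (Fin.toℕ-inject≤ j leaves≤)))
    ... | no  ≮  = contradiction (subst (_< length leaves) (sym (Fin.toℕ-inject≤ j leaves≤)) (Fin.toℕ<n j)) ≮

-- Keeping few vertices of each twin class

filter-length-mono : ∀ {A : Set} {P Q : Pred A 0ℓ} (P? : Decidable P) (Q? : Decidable Q) →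
  (∀ {x} → P x → Q x) → ∀ xs → length (filter P? xs) ≤ length (filter Q? xs)
filter-length-mono P? Q? P⇒Q []       = z≤n
filter-length-mono P? Q? P⇒Q (x ∷ xs) with P? x | Q? x
... | yes p | yes q = s≤s (filter-length-mono P? Q? P⇒Q xs)
... | yes p | no ¬q = contradiction (P⇒Q p) ¬q
... | no _  | yes q = m≤n⇒m≤1+n (filter-length-mono P? Q? P⇒Q xs)
... | no _  | no _  = filter-length-mono P? Q? P⇒Q xs

module TwinReduction {n} (G : Graph n) (k : ℕ) where
  open Graph G
  open GraphProperties G

  twin? : ∀ u v → Dec (Twin u v)
  twin? u v = map′ (λ all x → All.lookup all (∈-vertexList x)) (λ u~v → All.tabulate λ {x} _ → u~v x)
    (All.all? (λ x → adj u x Bool.≟ adj v x) (vertexList n))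

  -- Up to `k` twins selected before `v` still admit `v`, which makes `k + 1` per class.
  few? : ∀ v ys → Dec (length (filter (twin? v) ys) ≤ k)
  few? v ys = length (filter (twin? v) ys) ≤? k

  kept : List (Fin n)
  kept = greedy few? (vertexList n)

  kept-unique : Unique kept
  kept-unique = greedy-unique few? (vertexList-unique n)

  embed : Fin (length kept) → Fin n
  embed = lookup kept

  embed-injective : ∀ {s t} → embed s ≡ embed t → s ≡ t
  embed-injective = lookup-injective kept-unique

  many-twins : ∀ {v} → v ∉ kept →
    ∃[ ws ] Unique ws × k < length ws × All (λ w → ∃[ s ] Twin v (embed s) × embed s ≡ w) ws
  many-twins {v} v∉ =
    let (ys , ys⊆ , ys! , ¬few) = greedy-rejected few? (vertexList-unique n) (∈-vertexList v) v∉
    in filter (twin? v) ys , Unique.filter⁺ (twin? v) ys! , ≰⇒> ¬few , All.tabulate λ w∈ →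
       let (w∈ys , v~w) = ∈-filter⁻ (twin? v) {xs = ys} w∈
           w∈kept = ys⊆ w∈ys
           eq = Any.lookup-index w∈kept
       in Any.index w∈kept , subst (Twin v) eq v~w , sym eq

  -- A kept vertex is its own shadow. A deleted one has more than `k` kept twins, too many for `k`
  -- cops to occupy.
  free : ∀ (c : Fin k → Fin (length kept)) v → (∀ i → embed (c i) ≢ v) →
    ∃[ s ] Twin v (embed s) × (∀ i → c i ≢ s)
  free c v c≢v with _∈?_ Fin._≟_ v kept
  ... | yes v∈ = Any.index v∈ , (λ x → cong (λ u → adj u x) eq) , λ i c≡ → c≢v i (trans (cong embed c≡) (sym eq))
    where eq = Any.lookup-index v∈
  ... | no  v∉ with many-twins v∉
  ... | ws , ws! , k<ws , twins with Any.any? (λ w → Fin.all? (λ i → ¬? (embed (c i) Fin.≟ w))) ws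
  ... | yes w∈ =
    let (w , w∈ws , c≢w) = find w∈
        (s , v~s , eq)   = All.lookup twins w∈ws
    in s , v~s , λ i c≡ → c≢w i (trans (cong embed c≡) eq)
  ... | no  ¬w = contradiction (Fin.injective⇒≤ {f = occupant} occupant-injective) (<⇒≱ k<ws)
    where
    occupied : ∀ j → ∃[ i ] embed (c i) ≡ lookup ws j
    occupied j with Fin.any? (λ i → embed (c i) Fin.≟ lookup ws j)
    ... | yes found = found
    ... | no  none  = contradiction (Any.map (λ { refl i eq → none (i , eq) }) (∈-lookup {xs = ws} j)) ¬w
    occupant : Fin (length ws) → Fin k
    occupant j = proj₁ (occupied j)
    occupant-injective : ∀ {i j} → occupant i ≡ occupant j → i ≡ j
    occupant-injective {i} {j} eq = lookup-injective ws!
      (trans (sym (proj₂ (occupied i))) (trans (cong (embed ∘ c) eq) (proj₂ (occupied j))))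

  retract-spec : ∀ v → ∃[ s ] Twin v (embed s) × (∀ t → v ≡ embed t → s ≡ t)
  retract-spec v with _∈?_ Fin._≟_ v kept
  ... | yes v∈ = Any.index v∈ , (λ x → cong (λ u → adj u x) eq) , λ t eq′ → embed-injective (trans (sym eq) eq′)
    where eq = Any.lookup-index v∈
  ... | no  v∉ with many-twins v∉
  ... | _ ∷ _ , _ , _ , (s , v~s , _) ∷ _ = s , v~s , λ t v≡ → contradiction (subst (_∈ kept) (sym v≡) (∈-lookup t)) v∉

  retract : Fin n → Fin (length kept)
  retract v = proj₁ (retract-spec v)

  retract-twin : ∀ v → Twin v (embed (retract v))
  retract-twin v = proj₁ (proj₂ (retract-spec v))

  retract-embed : ∀ s → retract (embed s) ≡ s
  retract-embed s = proj₂ (proj₂ (retract-spec (embed s))) s refl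

  -- The number of twins selected earlier, that is, further back in the list. It is at most `k` by
  -- the greedy test, and it distinguishes the members of a class because it increases strictly
  -- along it.
  rank : (xs : List (Fin n)) → Fin (length xs) → ℕ
  rank (x ∷ xs) zero    = length (filter (twin? x) xs)
  rank (x ∷ xs) (suc j) = rank xs j

  rank-kept : ∀ j → rank kept j ≤ k
  rank-kept = greedy-invariant few? (λ xs → ∀ j → rank xs j ≤ k) (λ ())
    (λ { few ranks zero → few ; few ranks (suc j) → ranks j }) (vertexList n)

  rank< : ∀ {x} xs j → Twin x (lookup xs j) → rank xs j < length (filter (twin? x) xs)
  rank< {x} (y ∷ ys) zero    x~y rewrite filter-accept (twin? x) {xs = ys} x~y =
    s≤s (filter-length-mono (twin? y) (twin? x) (Twin-trans x~y) ys)
  rank< {x} (y ∷ ys) (suc j) x~ = ≤-trans (rank< ys j x~) (length-filter-∷ (twin? x y))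
    where
    length-filter-∷ : Dec (Twin x y) → length (filter (twin? x) ys) ≤ length (filter (twin? x) (y ∷ ys))
    length-filter-∷ (yes x~y) = subst (λ zs → _ ≤ length zs) (sym (filter-accept (twin? x) x~y)) (n≤1+n _)
    length-filter-∷ (no x≁y)  = ≤-reflexive (cong length (sym (filter-reject (twin? x) x≁y)))

  rank-injective : ∀ xs {i j} → Twin (lookup xs i) (lookup xs j) → rank xs i ≡ rank xs j → i ≡ j
  rank-injective (x ∷ xs) {zero}  {zero}  _   _  = refl
  rank-injective (x ∷ xs) {zero}  {suc j} x~  eq = contradiction (sym eq) (<⇒≢ (rank< xs j x~))
  rank-injective (x ∷ xs) {suc i} {zero}  x~  eq = contradiction eq (<⇒≢ (rank< xs i (Twin-sym x~)))
  rank-injective (x ∷ xs) {suc i} {suc j} i~j eq = cong suc (rank-injective xs i~j eq)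

  -- A kept vertex outside the cover is determined by its neighbours in the cover
  -- and its rank among its twins.
  length-kept : ∀ U → VertexCover U → k < ∣ U ∣ → length kept ≤ ∣ U ∣ + ∣ U ∣ * 2 ^ ∣ U ∣
  length-kept U cover k<p = Fin.injective⇒≤ {f = λ j → join p _ (code j)}
    (λ {i} {j} eq → code-injective {i} {j} (trans (sym (Fin.splitAt-join p _ (code i)))
                              (trans (cong (splitAt p) eq) (Fin.splitAt-join p _ (code j)))))
    where
    p = ∣ U ∣
    e = proj₁ (subset-elements U)
    onto = proj₂ (subset-elements U)
    bit : Bool → Fin 2
    bit false = zero
    bit true  = suc zero
    bit-injective : ∀ {a b} → bit a ≡ bit b → a ≡ b
    bit-injective {false} {false} _ = refl
    bit-injective {true}  {true}  _ = refl
    trace : Fin n → Fin (2 ^ p)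
    trace u = funToFin (λ i → bit (adj u (e i)))
    trace-twin : ∀ {u v} → u Subset.∉ U → v Subset.∉ U → trace u ≡ trace v → Twin u v
    trace-twin {u} {v} u∉ v∉ eq x with x Subset.∈? U
    ... | yes x∈ with onto x∈
    ... | i , refl = bit-injective (trans (sym (Fin.finToFun-funToFin _ i))
                       (trans (cong (λ c → finToFun c i) eq) (Fin.finToFun-funToFin _ i)))
    -- Outside the cover no two vertices are adjacent, so the traces need not record such `x`.
    trace-twin {u} {v} u∉ v∉ eq x | no x∉ with adj u x in eqᵤ | adj v x in eqᵥ
    ... | false | false = refl
    ... | true  | _     = contradiction (subst T (sym eqᵤ) _) (cover u x u∉ x∉)
    ... | false | true  = contradiction (subst T (sym eqᵥ) _) (cover v x v∉ x∉)
    rankInClass : Fin (length kept) → Fin p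
    -- The ranks from 0 to `k` are `k + 1` values, and `k + 1 ≤ p`: the strict inequality saves an
    -- additional summand `2 ^ p`.
    rankInClass j = fromℕ< (≤-<-trans (rank-kept j) k<p)
    code : Fin (length kept) → Fin p ⊎ Fin (p * 2 ^ p)
    code j with embed j Subset.∈? U
    ... | yes u∈ = inj₁ (proj₁ (onto u∈))
    ... | no  _  = inj₂ (combine (rankInClass j) (trace (embed j)))
    code-injective : ∀ {i j} → code i ≡ code j → i ≡ j
    code-injective {i} {j} eq with embed i Subset.∈? U | embed j Subset.∈? U
    ... | yes u∈ | yes v∈ =
      embed-injective (trans (sym (proj₂ (onto u∈))) (trans (cong e (inj₁-injective eq)) (proj₂ (onto v∈))))
    code-injective {i} {j} eq | no u∉ | no v∉ =
      let (rank≡ , trace≡) = Fin.combine-injective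
            (rankInClass i) (trace (embed i)) (rankInClass j) (trace (embed j)) (inj₂-injective eq)
      in rank-injective kept (trace-twin u∉ v∉ trace≡) (Fin.fromℕ<-injective _ _ _ _ rank≡)

-- Truncation of binary numbers to m digits.  The least significant digits are
-- dropped; in bijective numeration the result is still at least m.

dropDigit : ℕᵇ → ℕᵇ
dropDigit ℕᵇ.zero  = ℕᵇ.zero
dropDigit 2[1+ b ] = b
dropDigit 1+[2 b ] = b

dropDigits : ℕ → ℕᵇ → ℕᵇ
dropDigits zero    b = b
dropDigits (suc n) b = dropDigit (dropDigits n b)

encode-dropDigits : ∀ n b → encodeℕᵇ (dropDigits n b) ≡ tails n (encodeℕᵇ b)
encode-dropDigits zero    b = refl
encode-dropDigits (suc n) b = trans (encode-dropDigit (dropDigits n b)) (cong tail (encode-dropDigits n b))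
  where
  encode-dropDigit : ∀ b → encodeℕᵇ (dropDigit b) ≡ tail (encodeℕᵇ b)
  encode-dropDigit ℕᵇ.zero  = refl
  encode-dropDigit 2[1+ b ] = refl
  encode-dropDigit 1+[2 b ] = refl

digits : ℕᵇ → ℕ
digits b = spine (encodeℕᵇ b)

-- The digits are 1 and 2, never 0, so each digit contributes at least 1.
digits≤ : ∀ b → digits b ≤ fromBinary b
digits≤ ℕᵇ.zero  = z≤n
digits≤ 2[1+ b ] = ≤-trans (s≤s (digits≤ b)) (m≤m+n (suc (fromBinary b)) _)
digits≤ 1+[2 b ] = s≤s (≤-trans (digits≤ b) (m≤m+n (fromBinary b) _))

digits-dropDigits : ∀ n b → digits (dropDigits n b) ≡ digits b ∸ n
digits-dropDigits n b = trans (cong spine (encode-dropDigits n b)) (spine-tails n (encodeℕᵇ b))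

truncate : ℕ → ℕ → ℕ
truncate m s = fromBinary (dropDigits (digits (toBinary s) ∸ m) (toBinary s))

truncate-cases : ∀ m s → truncate m s ≡ s ⊎ (m < s × m ≤ truncate m s)
truncate-cases m s with digits (toBinary s) ≤? m
... | yes d≤m rewrite m≤n⇒m∸n≡0 d≤m = inj₁ (fromBinary-toBinary s)
... | no  d≰m = inj₂ (m<s , m≤truncate)
  where
  b = toBinary s
  m<d : m < digits b
  m<d = ≰⇒> d≰m
  m<s : m < s
  m<s = subst (m <_) (fromBinary-toBinary s) (≤-trans m<d (digits≤ b))
  m≤truncate : m ≤ truncate m s
  m≤truncate = ≤-trans
    (≤-reflexive (sym (trans (digits-dropDigits (digits b ∸ m) b) (m∸[m∸n]≡n (<⇒≤ m<d)))))
    (digits≤ (dropDigits (digits b ∸ m) b))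

encode-truncate : ∀ m s → encodeℕ (truncate m s) ≡ tails (spine (encodeℕ s) ∸ m) (encodeℕ s)
encode-truncate m s = trans (cong encodeℕᵇ (toBinary-fromBinary _)) (encode-dropDigits (digits (toBinary s) ∸ m) (toBinary s))

-- With `suc m` in place of `m` the truncation keeps at least one digit even for `m = 0`, so speeds
-- remain positive, and a unit speed is unchanged.
truncate>0 : ∀ m {s} → 0 < s → 0 < truncate (suc m) s
truncate>0 m {s} s>0 with truncate-cases (suc m) s
... | inj₁ eq       = subst (0 <_) (sym eq) s>0
... | inj₂ (_ , m<) = ≤-trans (s≤s z≤n) m<

truncate-unit : ∀ m {s} → s ≡ 1 → truncate (suc m) s ≡ 1
truncate-unit m {s} s≡1 with truncate-cases (suc m) s
... | inj₁ eq              = trans eq s≡1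
... | inj₂ (sm<s , _) with subst (suc m <_) s≡1 sm<s
... | s≤s ()

truncate-similar : ∀ m s → Similar m s (truncate (suc m) s)
truncate-similar m s with truncate-cases (suc m) s
... | inj₁ eq         = inj₁ (sym eq)
... | inj₂ (m< , ≤tr) = inj₂ (<⇒≤ (<⇒≤ m<) , <⇒≤ ≤tr)

truncateCop : ℕ → Cop → Cop
truncateCop m C = record
  { mode        = mode
  ; speed       = truncate (suc m) speed
  ; reach       = truncate (suc m) reach
  ; speed>0     = truncate>0 m speed>0
  ; active⇒unit = truncate-unit m ∘ active⇒unit
  }
  where open Cop C

truncateRobber : ℕ → Robber → Robber
truncateRobber m R = record
  { mode        = mode
  ; speed       = truncate (suc m) speed
  ; speed>0     = truncate>0 m speed>0
  ; active⇒unit = truncate-unit m ∘ active⇒unit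
  }
  where open Robber R

truncated : Instance → Instance
truncated I = withAgents I (truncateCop order ∘ cops) (truncateRobber order robber)
  where open Instance I

truncated-equivalent : ∀ I → Game.CopsWin I ⇔ Game.CopsWin (truncated I)
truncated-equivalent I = mk⇔
  (win-similar I similarCops similarRobber)
  (win-similar I (λ i → SimilarCop-sym {C = cops i} {truncateCop order (cops i)} (similarCops i))
    (SimilarRobber-sym {R = robber} {truncateRobber order robber} similarRobber))
  where
  open Instance I
  similarCops : ∀ i → SimilarCop order (cops i) (truncateCop order (cops i))
  similarCops i = refl , truncate-similar order _ , truncate-similar order _
  similarRobber : SimilarRobber order robber (truncateRobber order robber)
  similarRobber = refl , truncate-similar order _

-- The reduction of instances

-- Both graphs are empty, so that they respect the bound even for vertex cover number 0. Without
-- cops the empty placement wins; a cop without a vertex cannot be placed.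
yesInstance noInstance : Instance
yesInstance = record
  { order     = 0
  ; graph     = record { adj = λ () ; symm = λ () ; irrefl = λ () }
  ; connected = λ ()
  ; #cops     = 0
  ; cops      = λ ()
  ; robber    = record { mode = flexible ; speed = 1 ; speed>0 = s≤s z≤n ; active⇒unit = λ () }
  }
noInstance = record
  { order     = 0
  ; graph     = record { adj = λ () ; symm = λ () ; irrefl = λ () }
  ; connected = λ ()
  ; #cops     = 1
  ; cops      = λ _ → record
    { mode = flexible ; speed = 1 ; reach = 0 ; speed>0 = s≤s z≤n ; active⇒unit = λ () }
  ; robber    = record { mode = flexible ; speed = 1 ; speed>0 = s≤s z≤n ; active⇒unit = λ () }
  }

yesInstance-wins : Game.CopsWin yesInstance
yesInstance-wins = (λ ()) , λ ()

headOr : ∀ {A : Set} → A → List A → A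
headOr d []      = d
headOr d (x ∷ _) = x

-- The default `zero` does not occur in connected graphs of order at least 2. It agrees with
-- `head nil`, the numeral 0, so that the program imitates the choice without a case distinction.
neighbour : ∀ {n} → Graph (suc n) → Fin (suc n) → Fin (suc n)
neighbour G v = headOr zero (filter (λ w → T? (Graph.adj G v w)) (vertexList _))

neighbour-adjacent : ∀ {n} (G : Graph (suc (suc n))) → Graph.Connected G → ∀ v → Graph.Adj G v (neighbour G v)
neighbour-adjacent {n} G connected v = first (∈-filter⁺ (λ w → T? (adj v w)) (∈-vertexList (proj₁ exists)) (proj₂ exists))
  where
  open Graph G
  other : ∀ v → ∃[ u ] u ≢ v
  other zero    = suc zero , λ ()
  other (suc v) = zero , λ ()
  firstEdge : ∀ {u v ℓ} → v ≢ u → Walk u v ℓ → ∃[ w ] Adj u w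
  firstEdge v≢u []      = contradiction refl v≢u
  firstEdge v≢u (e ∷ _) = _ , e
  exists : ∃[ w ] Adj v w
  exists = firstEdge (proj₂ (other v)) (proj₂ (connected v (proj₁ (other v))))
  first : ∀ {w} → w ∈ filter (λ w → T? (adj v w)) (vertexList _) → Adj v (neighbour G v)
  first w∈ with filter (λ w → T? (adj v w)) (vertexList _) in eq
  ... | x ∷ _ = proj₂ (∈-filter⁻ (λ w → T? (adj v w)) {xs = vertexList _} (subst (x ∈_) (sym eq) (here refl)))

module _ (I : Instance) where
  open Instance I
  open TwinReduction graph #cops
  private
    module R = Retraction I embed embed-injective retract retract-twin retract-embed

  twinReduced : Instance
  twinReduced = R.restricted

  twinReduced-equivalent : Game.CopsWin I ⇔ Game.CopsWin twinReduced
  twinReduced-equivalent = mk⇔ R.win⇒win-restricted (R.Shadow.win-restricted⇒win free)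

unlessYes : ∀ {P : Set} → Dec P → Instance → Instance
unlessYes (yes _) J = yesInstance
unlessYes (no _)  J = J

-- Orders 0 and 1 are decided outright, since only from order 2 on does connectedness give every
-- vertex a neighbour. On a single vertex without cops, an active robber is stuck and loses, while a
-- flexible one stays forever.
reduce : Instance → Instance
reduce record { order = 0 ; #cops = 0 } = yesInstance
reduce record { order = 0 ; #cops = suc _ } = noInstance
reduce record { order = 1 ; #cops = 0 ; robber = record { mode = active } } = yesInstance
reduce record { order = 1 ; #cops = 0 ; robber = record { mode = flexible } } = noInstance
reduce record { order = 1 ; #cops = suc _ } = yesInstance
reduce I@record { order = suc (suc n) ; graph = G ; #cops = k } =
  unlessYes (length (Stars.leaves G (neighbour G)) ≤? k) (truncated (twinReduced I))

both-win : ∀ {A B : Set} → A → B → A ⇔ B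
both-win a b = mk⇔ (const b) (const a)

both-lose : ∀ {A B : Set} → ¬ A → ¬ B → A ⇔ B
both-lose ¬a ¬b = mk⇔ (λ a → contradiction a ¬a) (λ b → contradiction b ¬b)

noInstance-loses : ¬ Game.CopsWin noInstance
noInstance-loses (c , _) with c zero
... | ()

reduce-equivalent : ∀ I → Game.CopsWin I ⇔ Game.CopsWin (reduce I)
reduce-equivalent record { order = 0 ; #cops = 0 } = both-win ((λ ()) , λ ()) yesInstance-wins
reduce-equivalent record { order = 0 ; #cops = suc _ } =
  both-lose (λ (c , _) → contradiction (c zero) λ ()) noInstance-loses
reduce-equivalent I@record { order = 1 ; graph = G ; #cops = 0 ; robber = record { mode = active } } =
  both-win ((λ ()) , λ r _ → Game.continue (λ ()) stay λ r′ move →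
             contradiction (Game.RobberMove.activeMove move refl) (no-edge r r′))
           yesInstance-wins
  where
  stay : Game.CopMove I (λ ()) (λ ())
  stay = record { withinSpeed = λ () ; activeMove = λ () ; oneLazy = λ () }
  no-edge : ∀ u v → ¬ Graph.Adj G u v
  no-edge zero zero = GraphProperties.Adj-irrefl G
reduce-equivalent I@record { order = 1 ; #cops = 0 ; robber = record { mode = flexible } } =
  both-lose (λ (c , win) → never c zero (win zero λ ())) noInstance-loses
  where
  never : ∀ c r → ¬ Game.WinningStrategy I c r
  never c r (Game.continue c′ _ win) = never c′ r (win r record
    { walk = Graph.[] ; isPath = [] ∷ [] ; length≤ = z≤n ; unguarded = (λ ()) ∷ [] ; activeMove = λ () })
reduce-equivalent record { order = 1 ; #cops = suc _ } =
  both-win (const zero , λ { zero ¬g → contradiction (zero , 0 , z≤n , Graph.[]) ¬g }) yesInstance-wins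
reduce-equivalent I@record { order = suc (suc n) ; graph = G ; connected = connected ; #cops = k } =
  go (length (Stars.leaves G (neighbour G)) ≤? k)
  where
  go : (d : Dec (length (Stars.leaves G (neighbour G)) ≤ k)) →
    Game.CopsWin I ⇔ Game.CopsWin (unlessYes d (truncated (twinReduced I)))
  go (yes few) = both-win
    (Dominating.stars⇒win I (neighbour G) (neighbour-adjacent G connected) few zero) yesInstance-wins
  go (no _) = truncated-equivalent (twinReduced I) ⇔-∘ twinReduced-equivalent I

-- A program for the reduction

infix 9 ↑_
-- Weakening in the manner of de Bruijn indices: in the body of a loop the input lies behind the
-- current element, and in a greedy test also behind the selection.
↑_ : Feasible → Feasible
↑ p = tlᶠ ⨾ᶠ p

adjᶠ : Feasible → Feasible → Feasible → Feasible
adjᶠ g u v = atᶠ (atᶠ g u) v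

edgeᶠ coveredᶠ : Feasible → Feasible → Feasible → Feasible → Feasible

neighbourᶠ coversᶠ : Feasible → Feasible → Feasible → Feasible
neighbourᶠ l g v = filterᶠ l (adjᶠ (↑ g) (↑ v) hdᶠ) ⨾ᶠ hdᶠ
edgeᶠ l g u v = orᶠ (eqᶠ u v) (eqᶠ u (neighbourᶠ l g v))
coveredᶠ l g d u = filterᶠ l (andᶠ (notᶠ (memberᶠ hdᶠ (↑ d))) (edgeᶠ (↑ l) (↑ g) (↑ u) hdᶠ))
coversᶠ l g d = allᶠ l (coveredᶠ (↑ l) (↑ g) (↑ d) hdᶠ)

leavesᶠ : Feasible → Feasible → Feasible
leavesᶠ l g = greedyᶠ l (coversᶠ (↑ ↑ l) (↑ ↑ g) (consᶠ hdᶠ (# 1)))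

twinᶠ : Feasible → Feasible → Feasible → Feasible → Feasible
twinᶠ l g u v = allᶠ l (iffᶠ (adjᶠ (↑ g) (↑ u) hdᶠ) (adjᶠ (↑ g) (↑ v) hdᶠ))

keptᶠ : Feasible → Feasible → Feasible → Feasible
keptᶠ l g c = greedyᶠ l (leqᶠ (filterᶠ (# 1) (twinᶠ (↑ ↑ ↑ l) (↑ ↑ ↑ g) (# 1) hdᶠ)) (↑ ↑ c))

restrictᶠ : Feasible → Feasible → Feasible
restrictᶠ l g = mapᶠ l (mapᶠ (↑ l) (adjᶠ (↑ ↑ g) (# 1) hdᶠ))

truncateCopᶠ truncateRobberᶠ : Feasible → Feasible → Feasible
-- `consᶠ nilᶠ l` is one element longer than `l`; this is the `suc m` of `truncateCop`.
truncateCopᶠ l c =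
  consᶠ (c ⨾ᶠ hdᶠ) (consᶠ (truncateᶠ (consᶠ nilᶠ l) (c ⨾ᶠ # 1)) (truncateᶠ (consᶠ nilᶠ l) (c ⨾ᶠ tlᶠ ⨾ᶠ tlᶠ)))
truncateRobberᶠ l r = consᶠ (r ⨾ᶠ hdᶠ) (truncateᶠ (consᶠ nilᶠ l) (r ⨾ᶠ tlᶠ))

smallᶠ outputᶠ selectᶠ largeᶠ reduceᶠ : Feasible
-- The tests are for a vertex, for a cop and for the robber's mode, which is `nil` when he is
-- active.
smallᶠ  = ifᶠ (# 0) (ifᶠ (# 1) yesᶠ (ifᶠ (tlᶠ ⨾ᶠ tlᶠ ⨾ᶠ hdᶠ) noᶠ yesᶠ)) (ifᶠ (# 1) noᶠ yesᶠ)
  where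
  yesᶠ = literalᶠ (encodeInstance yesInstance)
  noᶠ  = literalᶠ (encodeInstance noInstance)
-- The input consists of the kept vertices, all vertices, the graph, the cops and the robber. The
-- robber is the remaining tail and not an element, hence four times `tlᶠ`.
outputᶠ = consᶠ (restrictᶠ (# 0) (# 2))
  (consᶠ (mapᶠ (# 3) (truncateCopᶠ (# 1) (# 0)))
         (truncateRobberᶠ (# 0) (tlᶠ ⨾ᶠ tlᶠ ⨾ᶠ tlᶠ ⨾ᶠ tlᶠ)))
selectᶠ = ifᶠ (leqᶠ (leavesᶠ (# 0) (# 1)) (# 2))
  (literalᶠ (encodeInstance yesInstance))
  (consᶠ (keptᶠ (# 0) (# 1) (# 2)) idᶠ ⨾ᶠ outputᶠ)
largeᶠ  = consᶠ (positionsᶠ hdᶠ) idᶠ ⨾ᶠ selectᶠ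
-- The tail of the adjacency matrix is nonempty exactly when the order is at least 2.
reduceᶠ = ifᶠ (hdᶠ ⨾ᶠ tlᶠ) largeᶠ smallᶠ

-- Correctness of the program

seq-spec : ∀ p q x → fun (p ⨾ᶠ q) x ≡ fun q (fun p x)
seq-spec p q x = refl

if-true-spec : ∀ b p q x → truth (fun b x) ≡ true → fun (ifᶠ b p q) x ≡ fun p x
if-true-spec b p q x b≡ with fun b x
... | _ ∙ _ = refl

encodeVertex : ∀ {n} → Fin n → Tree
encodeVertex v = numeral (toℕ v)

encodeVertices : ∀ {n} → List (Fin n) → Tree
encodeVertices vs = encodeList (map encodeVertex vs)

spine-encodeVertices : ∀ {n} (vs : List (Fin n)) → spine (encodeVertices vs) ≡ length vs
spine-encodeVertices vs = trans (spine-encodeList _) (length-map encodeVertex vs)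

spine-tabulate : ∀ {n} (f : Fin n → Tree) → spine (encodeList (toList f)) ≡ n
spine-tabulate f = trans (spine-encodeList _) (length-tabulate f)

head-encodeVertices : ∀ {n} (vs : List (Fin (suc n))) →
  head (encodeVertices vs) ≡ encodeVertex (headOr zero vs)
head-encodeVertices []       = refl
head-encodeVertices (_ ∷ _)  = refl

tabulate-lookup-map : ∀ {A B : Set} (f : A → B) xs → tabulate (f ∘ lookup xs) ≡ map f xs
tabulate-lookup-map f xs = trans (sym (map-tabulate (lookup xs) f)) (cong (map f) (tabulate-lookup xs))

branch-spec : ∀ {P : Set} (d : Dec P) b {y z} → truth b ≡ does d →
  branch b y z ≡ (Bool.if does d then y else z)
branch-spec (yes _) (_ ∙ _) _ = refl
branch-spec (no _)  nil     _ = refl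

module _ {n} (G : Graph (suc n)) where
  open Graph G
  private
    V = vertexList (suc n)

  adj-spec : ∀ g u v x {i j} → fun g x ≡ encodeGraph G → fun u x ≡ encodeVertex i → fun v x ≡ encodeVertex j →
    fun (adjᶠ g u v) x ≡ encodeBool (adj i j)
  adj-spec g u v x {i} {j} g≡ u≡ v≡ =
    at-spec (atᶠ g u) v x (λ w → encodeBool (adj i w)) j
      (at-spec g u x (λ w → encodeList (toList λ w′ → encodeBool (adj w w′))) i g≡ u≡) v≡

  truth-adj : ∀ g u v x {i j} → fun g x ≡ encodeGraph G → fun u x ≡ encodeVertex i → fun v x ≡ encodeVertex j →
    truth (fun (adjᶠ g u v) x) ≡ adj i j
  truth-adj g u v x g≡ u≡ v≡ = trans (cong truth (adj-spec g u v x g≡ u≡ v≡)) (truth-encodeBool _)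

  neighbour-spec : ∀ l g v x {i} → fun l x ≡ encodeVertices V → fun g x ≡ encodeGraph G →
    fun v x ≡ encodeVertex i → fun (neighbourᶠ l g v) x ≡ encodeVertex (neighbour G i)
  neighbour-spec l g v x {i} l≡ g≡ v≡ = trans
    (cong head (filter-spec {P? = λ w → T? (adj i w)} l (adjᶠ (↑ g) (↑ v) hdᶠ) x V l≡
      λ w → truth-adj (↑ g) (↑ v) hdᶠ (encodeVertex w ∙ x) g≡ v≡ refl))
    (head-encodeVertices (filter (λ w → T? (adj i w)) V))

  open Stars G (neighbour G)

  edge-spec : ∀ l g u v x {i j} → fun l x ≡ encodeVertices V → fun g x ≡ encodeGraph G →
    fun u x ≡ encodeVertex i → fun v x ≡ encodeVertex j →
    truth (fun (edgeᶠ l g u v) x) ≡ does (i Fin.≟ j ⊎-dec i Fin.≟ neighbour G j)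
  edge-spec l g u v x l≡ g≡ u≡ v≡ = trans (or-spec (eqᶠ u v) (eqᶠ u (neighbourᶠ l g v)) x) (cong₂ _∨_
    (eq-spec u v x u≡ v≡)
    (eq-spec u (neighbourᶠ l g v) x u≡ (neighbour-spec l g v x l≡ g≡ v≡)))

  covered-spec : ∀ l g d u x {D i} → fun l x ≡ encodeVertices V → fun g x ≡ encodeGraph G →
    fun d x ≡ encodeVertices D → fun u x ≡ encodeVertex i →
    truth (fun (coveredᶠ l g d u) x) ≡ does (covered? D i)
  covered-spec l g d u x {D} {i} l≡ g≡ d≡ u≡ =
    any-spec {P? = λ v → ¬? (_∈?_ Fin._≟_ v D) ×-dec (i Fin.≟ v ⊎-dec i Fin.≟ neighbour G v)}
      l (andᶠ (notᶠ p) q) x V l≡ λ v →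
    trans (and-spec (notᶠ p) q (encodeVertex v ∙ x)) (cong₂ _∧_
      (trans (not-spec p (encodeVertex v ∙ x))
             (cong not (member-spec hdᶠ (↑ d) (encodeVertex v ∙ x) v D refl d≡)))
      (edge-spec (↑ l) (↑ g) (↑ u) hdᶠ (encodeVertex v ∙ x) l≡ g≡ u≡ refl))
    where
    p = memberᶠ hdᶠ (↑ d)
    q = edgeᶠ (↑ l) (↑ g) (↑ u) hdᶠ

  covers-spec : ∀ l g d x {D} → fun l x ≡ encodeVertices V → fun g x ≡ encodeGraph G →
    fun d x ≡ encodeVertices D → truth (fun (coversᶠ l g d) x) ≡ does (covers? D)
  covers-spec l g d x {D} l≡ g≡ d≡ =
    all-spec {P? = covered? D} l (coveredᶠ (↑ l) (↑ g) (↑ d) hdᶠ) x V l≡ λ u →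
    covered-spec (↑ l) (↑ g) (↑ d) hdᶠ (encodeVertex u ∙ x) l≡ g≡ d≡ refl

  leaves-spec : ∀ l g x → fun l x ≡ encodeVertices V → fun g x ≡ encodeGraph G →
    fun (leavesᶠ l g) x ≡ encodeVertices leaves
  leaves-spec l g x l≡ g≡ = greedy-spec {P? = covers-with?} l
    (coversᶠ (↑ ↑ l) (↑ ↑ g) (consᶠ hdᶠ (# 1))) x V l≡ λ v D →
    covers-spec (↑ ↑ l) (↑ ↑ g) (consᶠ hdᶠ (# 1)) (encodeVertex v ∙ encodeVertices D ∙ x) {v ∷ D} l≡ g≡ refl

  module _ (k : ℕ) where
    open TwinReduction G k

    twin-spec : ∀ l g u v x {i j} → fun l x ≡ encodeVertices V → fun g x ≡ encodeGraph G →
      fun u x ≡ encodeVertex i → fun v x ≡ encodeVertex j →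
      truth (fun (twinᶠ l g u v) x) ≡ does (twin? i j)
    twin-spec l g u v x {i} {j} l≡ g≡ u≡ v≡ =
      all-spec {P? = λ w → adj i w Bool.≟ adj j w} l (iffᶠ p q) x V l≡ λ w →
      trans (iff-spec p q (encodeVertex w ∙ x)) (cong₂ (λ a b → does (a Bool.≟ b))
        (truth-adj (↑ g) (↑ u) hdᶠ (encodeVertex w ∙ x) g≡ u≡ refl)
        (truth-adj (↑ g) (↑ v) hdᶠ (encodeVertex w ∙ x) g≡ v≡ refl))
      where
      p = adjᶠ (↑ g) (↑ u) hdᶠ
      q = adjᶠ (↑ g) (↑ v) hdᶠ

    kept-spec : ∀ l g c x → fun l x ≡ encodeVertices V → fun g x ≡ encodeGraph G → spine (fun c x) ≡ k →
      fun (keptᶠ l g c) x ≡ encodeVertices kept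
    kept-spec l g c x l≡ g≡ c≡ = greedy-spec {P? = few?} l
      (leqᶠ (filterᶠ (# 1) (twinᶠ (↑ ↑ ↑ l) (↑ ↑ ↑ g) (# 1) hdᶠ)) (↑ ↑ c)) x V l≡ λ v ws →
      let y = encodeVertex v ∙ encodeVertices ws ∙ x
          twins = filterᶠ (# 1) (twinᶠ (↑ ↑ ↑ l) (↑ ↑ ↑ g) (# 1) hdᶠ)
          twins≡ = filter-spec {P? = twin? v} (# 1) (twinᶠ (↑ ↑ ↑ l) (↑ ↑ ↑ g) (# 1) hdᶠ) y ws refl λ w →
            twin-spec (↑ ↑ ↑ l) (↑ ↑ ↑ g) (# 1) hdᶠ (encodeVertex w ∙ y) l≡ g≡ refl refl
      in trans (leq-spec twins (↑ ↑ c) y) (cong₂ (λ a b → does (a ≤? b))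
           (trans (cong spine twins≡) (spine-encodeVertices (filter (twin? v) ws))) c≡)

  restrict-spec : ∀ l g x vs → fun l x ≡ encodeVertices vs → fun g x ≡ encodeGraph G →
    fun (restrictᶠ l g) x ≡ encodeGraph (restrict (lookup vs) G)
  restrict-spec l g x vs l≡ g≡ = trans
    (map-spec {β = λ u → encodeList (map (encodeBool ∘ adj u) vs)}
      l (mapᶠ (↑ l) (adjᶠ (↑ ↑ g) (# 1) hdᶠ)) x vs {λ u → u} l≡ λ u →
      map-spec {β = encodeBool} (↑ l) (adjᶠ (↑ ↑ g) (# 1) hdᶠ) (encodeVertex u ∙ x) vs {adj u} l≡ λ v →
      adj-spec (↑ ↑ g) (# 1) hdᶠ (encodeVertex v ∙ encodeVertex u ∙ x) g≡ refl refl)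
    (cong encodeList (trans
      (sym (tabulate-lookup-map (λ u → encodeList (map (encodeBool ∘ adj u) vs)) vs))
      (tabulate-cong λ s → cong encodeList (sym (tabulate-lookup-map (encodeBool ∘ adj (lookup vs s)) vs)))))

truncate-spec : ∀ m l x s → fun l x ≡ encodeℕ s →
  fun (truncateᶠ m l) x ≡ encodeℕ (truncate (spine (fun m x)) s)
truncate-spec m l x s l≡ = begin
  fun (truncateᶠ m l) x
    ≡⟨ drop-spec (dropᶠ m l) l x ⟩
  tails (spine (fun (dropᶠ m l) x)) (fun l x)
    ≡⟨ cong (λ t → tails (spine t) (fun l x)) (drop-spec m l x) ⟩
  tails (spine (tails (spine (fun m x)) (fun l x))) (fun l x)
    ≡⟨ cong (λ i → tails i (fun l x)) (spine-tails (spine (fun m x)) (fun l x)) ⟩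
  tails (spine (fun l x) ∸ spine (fun m x)) (fun l x)
    ≡⟨ cong (λ t → tails (spine t ∸ spine (fun m x)) t) l≡ ⟩
  tails (spine (encodeℕ s) ∸ spine (fun m x)) (encodeℕ s)
    ≡⟨ encode-truncate (spine (fun m x)) s ⟨
  encodeℕ (truncate (spine (fun m x)) s) ∎
  where open ≡-Reasoning

truncateCop-spec : ∀ l c x m C → spine (fun l x) ≡ m → fun c x ≡ encodeCop C →
  fun (truncateCopᶠ l c) x ≡ encodeCop (truncateCop m C)
truncateCop-spec l c x m C refl c≡ = cong₂ _∙_ (cong head c≡) (cong₂ _∙_
  (truncate-spec (consᶠ nilᶠ l) (c ⨾ᶠ # 1) x (Cop.speed C) (cong (head ∘ tail) c≡))
  (truncate-spec (consᶠ nilᶠ l) (c ⨾ᶠ tlᶠ ⨾ᶠ tlᶠ) x (Cop.reach C) (cong (tail ∘ tail) c≡)))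

truncateRobber-spec : ∀ l r x m R → spine (fun l x) ≡ m → fun r x ≡ encodeRobber R →
  fun (truncateRobberᶠ l r) x ≡ encodeRobber (truncateRobber m R)
truncateRobber-spec l r x m R refl r≡ = cong₂ _∙_ (cong head r≡)
  (truncate-spec (consᶠ nilᶠ l) (r ⨾ᶠ tlᶠ) x (Robber.speed R) (cong tail r≡))

module _ {n} (G : Graph (suc n)) {k} (cops : Vector Cop k) (R : Robber) where
  open TwinReduction G k using (kept)
  private
    C = encodeList (map encodeCop (toList cops))
    y = encodeVertices (vertexList (suc n)) ∙ encodeGraph G ∙ C ∙ encodeRobber R
    spine-C : spine C ≡ k
    spine-C = trans (spine-encodeList _) (trans (length-map encodeCop (toList cops)) (length-tabulate cops))

  output-spec : fun outputᶠ (encodeVertices kept ∙ y) ≡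
    encodeGraph (restrict (lookup kept) G)
    ∙ encodeList (map encodeCop (toList (truncateCop (length kept) ∘ cops)))
    ∙ encodeRobber (truncateRobber (length kept) R)
  output-spec = cong₂ _∙_ (restrict-spec G (# 0) (# 2) x kept refl refl) (cong₂ _∙_
    (trans (map-spec (# 3) (truncateCopᶠ (# 1) (# 0)) x (toList cops) {λ C → C} refl λ C →
             truncateCop-spec (# 1) (# 0) (encodeCop C ∙ x) (length kept) C (spine-encodeVertices kept) refl)
           (cong encodeList (trans (map-tabulate cops _) (sym (map-tabulate _ encodeCop)))))
    (truncateRobber-spec (# 0) (tlᶠ ⨾ᶠ tlᶠ ⨾ᶠ tlᶠ ⨾ᶠ tlᶠ) x (length kept) R (spine-encodeVertices kept) refl))
    where x = encodeVertices kept ∙ y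

  input : Tree
  input = encodeGraph G ∙ C ∙ encodeRobber R

  positions-step : fun (consᶠ (positionsᶠ hdᶠ) idᶠ) input ≡ y
  positions-step = cong (_∙ input) (trans (positions-spec hdᶠ input)
    (trans (cong numerals (spine-tabulate (λ u → encodeList (toList λ v → encodeBool (Graph.adj G u v)))))
           (encodeList-numerals (suc n))))

  select-spec : (conn : Graph.Connected G) → fun selectᶠ y ≡
    encodeInstance (unlessYes (length (Stars.leaves G (neighbour G)) ≤? k)
      (truncated (twinReduced
        (record { order = suc n ; graph = G ; connected = conn ; #cops = k ; cops = cops ; robber = R }))))
  select-spec conn = trans
    (branch-spec d (fun (leqᶠ (leavesᶠ (# 0) (# 1)) (# 2)) y)
      (trans (leq-spec (leavesᶠ (# 0) (# 1)) (# 2) y)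
        (cong₂ (λ a b → does (a ≤? b))
          (trans (cong spine (leaves-spec G (# 0) (# 1) y refl refl)) (spine-encodeVertices leaves)) spine-C)))
    (go d)
    where
    open Stars G (neighbour G)
    d = length leaves ≤? k
    reduced = truncated (twinReduced
        (record { order = suc n ; graph = G ; connected = conn ; #cops = k ; cops = cops ; robber = R }))
    go : ∀ {P} (d : Dec P) →
      (Bool.if does d then encodeInstance yesInstance else fun outputᶠ (fun (keptᶠ (# 0) (# 1) (# 2)) y ∙ y))
      ≡ encodeInstance (unlessYes d reduced)
    go (yes _) = refl
    go (no _)  = trans (cong (λ K → fun outputᶠ (K ∙ y)) (kept-spec G k (# 0) (# 1) (# 2) y refl refl spine-C)) output-spec

  large-spec : (conn : Graph.Connected G) → fun largeᶠ input ≡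
    encodeInstance (unlessYes (length (Stars.leaves G (neighbour G)) ≤? k)
      (truncated (twinReduced
        (record { order = suc n ; graph = G ; connected = conn ; #cops = k ; cops = cops ; robber = R }))))
  large-spec conn = trans (seq-spec (consᶠ (positionsᶠ hdᶠ) idᶠ) selectᶠ input)
    (trans (cong (fun selectᶠ) positions-step) (select-spec conn))

reduce-spec : ∀ I → fun reduceᶠ (encodeInstance I) ≡ encodeInstance (reduce I)
reduce-spec record { order = 0 ; #cops = 0 }     = refl
reduce-spec record { order = 0 ; #cops = suc _ } = refl
reduce-spec record { order = 1 ; #cops = 0 ; robber = record { mode = active } }   = refl
reduce-spec record { order = 1 ; #cops = 0 ; robber = record { mode = flexible } } = refl
reduce-spec record { order = 1 ; #cops = suc _ } = refl
reduce-spec I@record { order = suc (suc n) ; graph = G ; connected = connected ; cops = cops ; robber = R } =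
  trans (if-true-spec (hdᶠ ⨾ᶠ tlᶠ) largeᶠ smallᶠ (encodeInstance I) refl) (large-spec G cops R connected)

feasible⇒polynomialTime : ∀ {A : Set} {encode : A → Tree} {f : A → A} (p : Feasible) →
  (∀ x → fun p (encode x) ≡ encode (f x)) → PolynomialTime encode f
feasible⇒polynomialTime {encode = encode} {f} p spec = prog p , coefficient P , degree P , λ x →
  time p (encode x) ,
  subst (λ y → prog p ⊢ encode x ⇓ y cost time p (encode x)) (spec x) (runs p (encode x)) ,
  subst (λ y → time p (encode x) + size y ≤ coefficient P * size (encode x) ^ degree P) (spec x)
    (≤-trans (bound p (encode x)) (eval-size≤ (encode x)))
  where
  P = polynomial p
  eval-size≤ : ∀ t → eval P (size t) ≤ coefficient P * size t ^ degree P
  eval-size≤ nil     = eval≤monomial P 0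
  eval-size≤ (a ∙ b) = eval≤monomial P (size a + size b)

reduce-polynomial : PolynomialTime encodeInstance reduce
reduce-polynomial = feasible⇒polynomialTime {encode = encodeInstance} {f = reduce} reduceᶠ reduce-spec

-- Sizes of encodings

numberBound graphBound copsBound instanceBound : Polynomial
-- Each of the `suc m` digits takes up to 3 nodes and one pairing.
numberBound   = con 1 ⊕ con 4 ⊗ (con 1 ⊕ X)
graphBound    = con 1 ⊕ X ⊗ (con 1 ⊕ (con 1 ⊕ X ⊗ con 4))
copsBound     = con 1 ⊕ X ⊗ (con 1 ⊕ (con 6 ⊕ (con 1 ⊕ (numberBound ⊕ numberBound))))
instanceBound =
  -- This summand accommodates the two constant outputs.
  con (size (encodeInstance noInstance)) ⊕
  (con 1 ⊕ (graphBound ⊕ (con 1 ⊕ (copsBound ⊕ (con 4 ⊕ numberBound)))))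

size-encodeBool : ∀ b → size (encodeBool b) ≤ 3
size-encodeBool false = s≤s z≤n
size-encodeBool true  = ≤-refl

size-encodeCopMode : ∀ m → size (encodeCopMode m) ≤ 5
size-encodeCopMode active   = s≤s z≤n
size-encodeCopMode lazy     = s≤s (s≤s (s≤s z≤n))
size-encodeCopMode flexible = ≤-refl

size-encodeRobberMode : ∀ m → size (encodeRobberMode m) ≤ 3
size-encodeRobberMode active   = s≤s z≤n
size-encodeRobberMode flexible = ≤-refl

size-encodeℕᵇ : ∀ b → size (encodeℕᵇ b) ≤ 1 + 4 * digits b
size-encodeℕᵇ ℕᵇ.zero  = ≤-refl
size-encodeℕᵇ 2[1+ b ] = size-digit (encodeBool false) (size-encodeBool false) b (size-encodeℕᵇ b)
  where
  size-digit : ∀ t → size t ≤ 3 → ∀ b → size (encodeℕᵇ b) ≤ 1 + 4 * digits b →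
    suc (size t + size (encodeℕᵇ b)) ≤ 1 + 4 * suc (digits b)
  size-digit t t≤ b b≤ = s≤s (≤-trans (+-mono-≤ t≤ b≤) (≤-reflexive (sym (*-suc 4 (digits b)))))
size-encodeℕᵇ 1+[2 b ] =
  s≤s (≤-trans (+-monoʳ-≤ 3 (size-encodeℕᵇ b)) (≤-reflexive (sym (*-suc 4 (digits b)))))

size-truncate : ∀ m s → size (encodeℕ (truncate m s)) ≤ 1 + 4 * m
size-truncate m s = ≤-trans (size-encodeℕᵇ _) (s≤s (*-monoʳ-≤ 4 (begin
  spine (encodeℕ (truncate m s))   ≡⟨ cong spine (encode-truncate m s) ⟩
  spine (tails (d ∸ m) (encodeℕ s)) ≡⟨ spine-tails (d ∸ m) (encodeℕ s) ⟩
  d ∸ (d ∸ m)                      ≤⟨ m∸[m∸n]≤n d m ⟩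
  m                                ∎)))
  where
  open ≤-Reasoning
  d = spine (encodeℕ s)
  m∸[m∸n]≤n : ∀ m n → m ∸ (m ∸ n) ≤ n
  m∸[m∸n]≤n m n with ≤-total n m
  ... | inj₁ n≤m = ≤-reflexive (m∸[m∸n]≡n n≤m)
  ... | inj₂ m≤n = ≤-trans (m∸n≤m m (m ∸ n)) m≤n

size-encodeList-tabulate : ∀ {n B} (f : Fin n → Tree) → (∀ i → size (f i) ≤ B) →
  size (encodeList (tabulate f)) ≤ 1 + n * (1 + B)
size-encodeList-tabulate {n} {B} f f≤ = subst (λ k → size (encodeList (tabulate f)) ≤ 1 + k * (1 + B))
  (length-tabulate f) (size-encodeList (All.tabulate⁺ f≤))

size-encodeGraph : ∀ {n} (G : Graph n) → size (encodeGraph G) ≤ eval graphBound n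
size-encodeGraph G = size-encodeList-tabulate _ λ u → size-encodeList-tabulate _ λ v → size-encodeBool _

size-truncateCop : ∀ m C → size (encodeCop (truncateCop m C)) ≤ 6 + (1 + (eval numberBound m + eval numberBound m))
size-truncateCop m C = s≤s (+-mono-≤ (size-encodeCopMode mode)
  (s≤s (+-mono-≤ (size-truncate (suc m) speed) (size-truncate (suc m) reach))))
  where open Cop C

size-truncateRobber : ∀ m R → size (encodeRobber (truncateRobber m R)) ≤ 4 + eval numberBound m
size-truncateRobber m R = s≤s (+-mono-≤ (size-encodeRobberMode mode) (size-truncate (suc m) speed))
  where open Robber R

-- After truncation every number has at most one digit more than the order, so order and number of
-- cops control the whole encoding.
size-truncated : ∀ I {B} → Instance.order I ≤ B → Instance.#cops I ≤ B →
  size (encodeInstance (truncated I)) ≤ eval instanceBound B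
size-truncated I {B} order≤ #cops≤ = ≤-trans
  (s≤s (+-mono-≤ (≤-trans (size-encodeGraph graph) (eval-mono graphBound order≤))
    (s≤s (+-mono-≤ cops≤ (≤-trans (size-truncateRobber order robber) (+-monoʳ-≤ 4 (eval-mono numberBound order≤)))))))
  (m≤n+m _ (size (encodeInstance noInstance)))
  where
  open Instance I
  cops′ = truncateCop order ∘ cops
  copBound = 6 + (1 + (eval numberBound order + eval numberBound order))
  cops≤ : size (encodeList (map encodeCop (toList (truncateCop order ∘ cops)))) ≤ eval copsBound B
  cops≤ = ≤-trans
    (size-encodeList {copBound} (All.map⁺ (All.tabulate⁺ λ i → size-truncateCop order (cops i))))
    (s≤s (*-mono-≤ (≤-trans (≤-reflexive (trans (length-map encodeCop (toList cops′)) (length-tabulate cops′))) #cops≤)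
      (s≤s (+-monoʳ-≤ 7 (+-mono-≤ (eval-mono numberBound order≤) (eval-mono numberBound order≤))))))

size-noInstance : ∀ n → size (encodeInstance noInstance) ≤ eval instanceBound n
size-noInstance n = m≤m+n (size (encodeInstance noInstance)) _

size-yesInstance : ∀ n → size (encodeInstance yesInstance) ≤ eval instanceBound n
size-yesInstance n = ≤-trans (≤ᵇ⇒≤ (size (encodeInstance yesInstance)) (size (encodeInstance noInstance)) _) (size-noInstance n)

-- The vertex cover number bounds the number of stars, hence the number of cops
-- in an instance that is not trivially positive.
reduce-bounds : ∀ I p → Graph.VertexCoverNumber (Instance.graph I) p →
  Instance.order (reduce I) ≤ orderBound p ×
  size (encodeInstance (reduce I)) ≤ eval instanceBound (orderBound p)
reduce-bounds record { order = 0 ; #cops = 0 } p _     = z≤n , size-yesInstance (orderBound p)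
reduce-bounds record { order = 0 ; #cops = suc _ } p _ = z≤n , size-noInstance (orderBound p)
reduce-bounds record { order = 1 ; #cops = 0 ; robber = record { mode = active } } p _   = z≤n , size-yesInstance (orderBound p)
reduce-bounds record { order = 1 ; #cops = 0 ; robber = record { mode = flexible } } p _ = z≤n , size-noInstance (orderBound p)
reduce-bounds record { order = 1 ; #cops = suc _ } p _ = z≤n , size-yesInstance (orderBound p)
reduce-bounds I@record { order = suc (suc n) ; graph = G ; connected = connected ; #cops = k } p ((U , cover , refl) , _) =
  go (length leaves ≤? k)
  where
  open Stars G (neighbour G)
  open TwinReduction G k
  go : (d : Dec (length leaves ≤ k)) →
    Instance.order (unlessYes d (truncated (twinReduced I))) ≤ orderBound p ×
    size (encodeInstance (unlessYes d (truncated (twinReduced I)))) ≤ eval instanceBound (orderBound p)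
  go (yes _)    = z≤n , size-yesInstance (orderBound p)
  -- The number of cops has to be bounded as well: it is below `p`, hence below the bound on the
  -- order.
  go (no many) = order≤ , size-truncated (twinReduced I) order≤ (≤-trans (<⇒≤ k<p) (m≤m+n p _))
    where
    k<p : k < ∣ U ∣
    k<p = ≤-trans (≰⇒> many) (leaves≤cover (neighbour-adjacent G connected) U cover)
    order≤ : length kept ≤ orderBound p
    order≤ = length-kept U cover k<p

theorem9 : Σ[ K ∈ Kernel GeneralizedCopsAndRobber/vcn ]
    (∀ (I : Instance) (vcn : ℕ) → Graph.VertexCoverNumber (Instance.graph I) vcn →
    Instance.order (Kernel.reduce K I) ≤ vcn + vcn * 2 ^ vcn)
theorem9 = kernel , λ I p vcn≡p → proj₁ (reduce-bounds I p vcn≡p)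
  where
  kernel : Kernel GeneralizedCopsAndRobber/vcn
  kernel = record
    { reduce     = reduce
    ; polynomial = reduce-polynomial
    ; equivalent = reduce-equivalent
    ; bound      = eval instanceBound ∘ orderBound
    ; computable = computable-orderBound instanceBound
    ; bounded    = λ I p vcn≡p → proj₂ (reduce-bounds I p vcn≡p)
    }
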